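{- Let $n \geq 2$ and let $p > n$ be an odd prime. Let $w_1,\ldots,w_n$ be rational numbers with denominators prime to $p$ such that $w_1 \equiv Q_p(1) \pmod{p}$ and, for $\ell = 2,\ldots,n$, \[ w_\ell \equiv Q_p(1) + p\,w_{\ell-1} + \sum_{\nu=1}^{\ell-1} p^\nu\Bigl(\widehat\sigma_{\nu+1}(Q_p) + \binom{p-1}{\nu+1}(-1)^\nu\, w_{\ell-\nu}^{\nu+1}\Bigr) \pmod{p^\ell}. \] Then $W_p \equiv w_n \pmod{p^n}$.
   Context: $W_p = ((p-1)!+1)/p$ is the Wilson quotient, $q_p(a) = (a^{p-1}-1)/p$ the Fermat quotient, and $Q_p(m) = \sum_{a=1}^{p-1} q_p(a)^m$. Complete Bell polynomials: $B_k(y_1,\ldots,y_k) = \sum_{i=1}^k B_{k,i}$ where $B_{k,i}(y_1,\ldots,y_{k-i+1}) = \sum \frac{k!}{j_1!\cdots}\prod_{r}(y_r/r!)^{j_r}$ over nonnegative $j_r$ with $\sum r j_r = k$, $\sum j_r = i$. For $k \geq 1$, $\widehat\sigma_k(\pi_1,\ldots,\pi_k) = \frac{(-1)^k}{k!} B_k(-\pi_1, -1!\,\pi_2, \ldots, -(k-1)!\,\pi_k)$ (the expression of the $k$-th elementary symmetric polynomial in terms of power sums $\pi_1,\ldots,\pi_k$), and $\widehat\sigma_k(Q_p) = \widehat\sigma_k(Q_p(1),\ldots,Q_p(k))$. -}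

module Defs where

open import Data.Nat as ℕ using (ℕ; zero; suc; _∸_; _!; NonZero)
open import Data.Nat.Properties using (_!≢0)
open import Data.Nat.Combinatorics using (_C_)
open import Data.Integer as ℤ using (ℤ; +_; 1ℤ; -1ℤ)
open import Data.Integer.Divisibility as ℤD using ()
open import Data.Rational using (ℚ; _/_; _+_; _*_; _-_; -_; 0ℚ; 1ℚ; ↥_)
open import Data.List using (List; []; _∷_; concatMap; map; filter; foldr)
open import Data.Vec using (Vec; []; _∷_)
open import Data.Fin using (Fin; toℕ)
open import Relation.Nullary.Decidable using (_×-dec_)
open import Data.Product using (_×_)
open import Relation.Binary.PropositionalEquality using (_≡_)

ℕtoℚ : ℕ → ℚ
ℕtoℚ n = + n / 1

_^Q_ : ℚ → ℕ → ℚ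
x ^Q zero = 1ℚ
x ^Q suc k = x * (x ^Q k)

invFact : ℕ → ℚ
invFact r = (1ℤ / (r !)) {{r !≢0}}

sumTo : ℕ → (ℕ → ℚ) → ℚ
sumTo zero f = 0ℚ
sumTo (suc m) f = sumTo m f + f (suc m)

sumList : List ℚ → ℚ
sumList = foldr _+_ 0ℚ

prodList : List ℚ → ℚ
prodList = foldr _*_ 1ℚ

fermatQ : (p : ℕ) → .{{NonZero p}} → ℕ → ℚ
fermatQ p a = (+ (a ℕ.^ (p ∸ 1)) ℤ.- 1ℤ) / p

Qp : (p : ℕ) → .{{NonZero p}} → ℕ → ℚ
Qp p m = sumTo (p ∸ 1) (λ a → fermatQ p a ^Q m)

wilsonQ : (p : ℕ) → .{{NonZero p}} → ℚ
wilsonQ p = (+ ((p ∸ 1) ! ℕ.+ 1)) / p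

allVecs : (m b : ℕ) → List (Vec ℕ m)
allVecs zero b = [] ∷ []
allVecs (suc m) b = concatMap (λ v → map (λ x → x ∷ v) (range b)) (allVecs m b)
  where
  range : ℕ → List ℕ
  range zero = zero ∷ []
  range (suc c) = suc c ∷ range c

-- for j = (j_1,…,j_m) (stored as a Vec, entry at index i is j_{i+1}):
-- weight Σ r j_r, size Σ j_r
weight : ∀ {m} → Vec ℕ m → ℕ
weight {m} v = go 1 v
  where
  go : ∀ {k} → ℕ → Vec ℕ k → ℕ
  go r [] = 0
  go r (x ∷ xs) = r ℕ.* x ℕ.+ go (suc r) xs

size : ∀ {m} → Vec ℕ m → ℕ
size [] = 0
size (x ∷ xs) = x ℕ.+ size xs

bellTerm : (k : ℕ) → (y : ℕ → ℚ) → ∀ {m} → Vec ℕ m → ℚ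
bellTerm k y v = ℕtoℚ (k !) * go 1 v
  where
  go : ∀ {l} → ℕ → Vec ℕ l → ℚ
  go r [] = 1ℚ
  go r (j ∷ js) = invFact j * ((y r * invFact r) ^Q j) * go (suc r) js

-- partial Bell polynomial B_{k,i}(y_1,…,y_{k-i+1}):
-- sum over (j_1,…,j_k) of nonnegative integers with Σ r j_r = k, Σ j_r = i
-- (entries are automatically ≤ k; j_r = 0 for r > k-i+1 is forced).
bellPartial : (k i : ℕ) → (y : ℕ → ℚ) → ℚ
bellPartial k i y =
  sumList (map (bellTerm k y)
    (filter (λ v → (weight v ℕ.≟ k) ×-dec (size v ℕ.≟ i)) (allVecs k k)))

bell : (k : ℕ) → (y : ℕ → ℚ) → ℚ
bell k y = sumTo k (λ i → bellPartial k i y)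

-- σ̂_k(π_1,…,π_k) = (-1)^k/k! · B_k(-π_1, -1!π_2, …, -(k-1)!π_k);
-- π is indexed from 1 (π r = π_r).
sigmaHat : ℕ → (ℕ → ℚ) → ℚ
sigmaHat k π = ((- 1ℚ) ^Q k) * invFact k
               * bell k (λ r → - (ℕtoℚ ((r ∸ 1) !) * π r))

sigmaHatQ : (p : ℕ) → .{{NonZero p}} → ℕ → ℚ
sigmaHatQ p k = sigmaHat k (Qp p)

-- a ≡ b (mod M) for rationals (with denominators prime to p, M a power of p):
-- M divides the numerator of the reduced fraction a - b
CongQ : ℕ → ℚ → ℚ → Set
CongQ M a b = (+ M) ℤD.∣ (↥ (a - b))

-- right-hand side of the congruence for w_ℓ (ℓ ≥ 2); w indexed from 1
recRHS : (p : ℕ) → .{{NonZero p}} → (ℕ → ℚ) → ℕ → ℚ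
recRHS p w ℓ =
  Qp p 1 + ℕtoℚ p * w (ℓ ∸ 1)
  + sumTo (ℓ ∸ 1) (λ ν →
      (ℕtoℚ p ^Q ν) *
        (sigmaHatQ p (suc ν)
         + ℕtoℚ ((p ∸ 1) C (suc ν)) * ((- 1ℚ) ^Q ν) * (w (ℓ ∸ ν) ^Q suc ν)))

{-# OPTIONS --safe #-}
module Submission where

-- Let q_a be the Fermat quotients and W the Wilson quotient, so 1 + p q_a = a^(p-1) and
-- p W - 1 = (p-1)!.  Since p - 1 is even, (1 - p W)^(p-1) = ∏ (1 + p q_a); expanding both sides,
-- cancelling 1 and dividing by p shows that W satisfies the recursion for w_ℓ with every w_i
-- replaced by W, up to terms divisible by p^ℓ.  As p^ν w_{ℓ-ν}^{ν+1} modulo p^ℓ depends only on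
-- w_{ℓ-ν} modulo p^{ℓ-ν}, induction on ℓ gives w_ℓ ≡ W (mod p^ℓ).
--
-- That σ̂_k gives elementary symmetric polynomials is seen on generating functions:
-- ∏ (1 - q_a t) and exp (- Σ π_r t^r / r) have the same logarithmic derivative.  The p-integrality
-- of W (Wilson's theorem) comes from Fermat's theorem and the (p-1)-st finite difference of x^(p-1).

open import Defs
open import Data.Nat as ℕ using (ℕ; zero; suc; z≤n; s≤s; _∸_; _!; _≤_; _<_; _^_; NonZero)
import Data.Nat.Properties as ℕₚ
open import Data.Integer as ℤ using (ℤ)
import Data.Integer.Properties as ℤₚ
open import Data.Rational using (ℚ; 0ℚ; 1ℚ; _+_; _*_; _-_; -_; _/_; ↥_; ↧_; ↧ₙ_; mkℚ; toℚᵘ)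
open import Data.Rational.Properties as ℚₚ using (toℚᵘ-injective; toℚᵘ-fromℚᵘ; toℚᵘ-homo-+; toℚᵘ-homo-*; ↥p/↧p≡p)
open import Data.Rational.Unnormalised as ℚᵘ using (mkℚᵘ; *≡*)
import Data.Rational.Unnormalised.Properties as ℚᵘₚ
open import Data.Bool using (if_then_else_; true; false; _∧_)
open import Data.List using (List; []; _∷_; _++_; map; filter; concatMap)
open import Data.Product using (_×_; _,_; proj₁)
open import Data.Nat.Combinatorics using (_C_; nC1≡n; k>n⇒nCk≡0; nCk≡nC[n∸k]; nCn≡1; nCk+nC[k+1]≡[n+1]C[k+1])
open import Data.Nat.Divisibility using (_∣_; divides; >⇒∤; ∣-refl; ∣-trans; m∣m*n; 1∣_; *-cancelʳ-∣; *-monoˡ-∣; ∣m∣n⇒∣m+n; ∣1⇒≡1)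
open import Data.Nat.Primality using (Prime; euclidsLemma; ¬prime[1])
open import Data.Nat.Coprimality as Coprime using (Coprime)
import Data.Integer.Divisibility as ℤD
import Data.Integer.Divisibility.Signed as ℤ∣
open import Data.Sum using (inj₁; inj₂)
open import Data.Vec using (Vec; []; _∷_)
open import Data.Empty using (⊥-elim)
open import Function using (_∘_)
open import Relation.Nullary using (Dec; yes; no; does; ¬_)
open import Relation.Nullary.Decidable using (dec⇒maybe; _×-dec_; dec-true; dec-false)
open import Relation.Binary.PropositionalEquality using (_≡_; _≢_; refl; sym; trans; cong; cong₂; subst; subst₂; module ≡-Reasoning)
open import Tactic.RingSolver using (solve-∀)
open import Tactic.RingSolver.Core.AlmostCommutativeRing using (AlmostCommutativeRing; fromCommutativeRing)

-- The Bell polynomials are finite sums over exponent vectors with bounded entries, so what they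
-- produce is a product of truncated exponentials. Such a product satisfies the differential
-- equation of the exponential only up to a certain index; this is why `LogDeriv` carries a bound.
-- Stating everything through t·d/dt avoids formal exponentials and logarithms: a first-order
-- equation together with the constant term fixes the coefficients. The product form of `sigmaHat`
-- is used twice. Evaluated at t = -p it gives the expansion of the product of the 1 + p q_a, and it
-- shows that each `sigmaHat` of the Fermat quotients is p-integral, which the division by k! in the
-- Bell form hides. Without integrality the terms beyond p^ℓ could not be discarded. The lone w_ℓ on
-- the left of the recursion comes from the linear binomial term: (p-1) W = p W - W. The part p W
-- becomes p w_{ℓ-1}, and - W is moved to the other side.

ℚ-ring : AlmostCommutativeRing _ _
ℚ-ring = fromCommutativeRing ℚₚ.+-*-commutativeRing λ x → dec⇒maybe (0ℚ ℚₚ.≟ x)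

-- Embedding the integers into the rationals; inverse factorials.

ℤtoℚ : ℤ → ℚ
ℤtoℚ i = i / 1

ℤtoℚ-+ : ∀ i j → ℤtoℚ (i ℤ.+ j) ≡ ℤtoℚ i + ℤtoℚ j
ℤtoℚ-+ i j = toℚᵘ-injective (let open ℚᵘₚ.≃-Reasoning in begin
  toℚᵘ (ℤtoℚ (i ℤ.+ j))              ≈⟨ toℚᵘ-fromℚᵘ (mkℚᵘ (i ℤ.+ j) 0) ⟩
  mkℚᵘ (i ℤ.+ j) 0                   ≈⟨ *≡* (cong (ℤ._* ℤ.+ 1) (cong₂ ℤ._+_ (sym (ℤₚ.*-identityʳ i)) (sym (ℤₚ.*-identityʳ j)))) ⟩
  mkℚᵘ i 0 ℚᵘ.+ mkℚᵘ j 0             ≈⟨ ℚᵘₚ.+-cong (toℚᵘ-fromℚᵘ (mkℚᵘ i 0)) (toℚᵘ-fromℚᵘ (mkℚᵘ j 0)) ⟨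
  toℚᵘ (ℤtoℚ i) ℚᵘ.+ toℚᵘ (ℤtoℚ j)   ≈⟨ toℚᵘ-homo-+ (ℤtoℚ i) (ℤtoℚ j) ⟨
  toℚᵘ (ℤtoℚ i + ℤtoℚ j)             ∎)

ℤtoℚ-* : ∀ i j → ℤtoℚ (i ℤ.* j) ≡ ℤtoℚ i * ℤtoℚ j
ℤtoℚ-* i j = toℚᵘ-injective (let open ℚᵘₚ.≃-Reasoning in begin
  toℚᵘ (ℤtoℚ (i ℤ.* j))              ≈⟨ toℚᵘ-fromℚᵘ (mkℚᵘ (i ℤ.* j) 0) ⟩
  mkℚᵘ i 0 ℚᵘ.* mkℚᵘ j 0             ≈⟨ ℚᵘₚ.*-cong (toℚᵘ-fromℚᵘ (mkℚᵘ i 0)) (toℚᵘ-fromℚᵘ (mkℚᵘ j 0)) ⟨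
  toℚᵘ (ℤtoℚ i) ℚᵘ.* toℚᵘ (ℤtoℚ j)   ≈⟨ toℚᵘ-homo-* (ℤtoℚ i) (ℤtoℚ j) ⟨
  toℚᵘ (ℤtoℚ i * ℤtoℚ j)             ∎)

/-cancelʳ : ∀ i n .{{_ : ℕ.NonZero n}} → (i / n) * ℕtoℚ n ≡ ℤtoℚ i
/-cancelʳ i (suc n) = toℚᵘ-injective (let open ℚᵘₚ.≃-Reasoning in begin
  toℚᵘ ((i / suc n) * ℕtoℚ (suc n))             ≈⟨ toℚᵘ-homo-* (i / suc n) (ℕtoℚ (suc n)) ⟩
  toℚᵘ (i / suc n) ℚᵘ.* toℚᵘ (ℕtoℚ (suc n))     ≈⟨ ℚᵘₚ.*-cong (toℚᵘ-fromℚᵘ (mkℚᵘ i n)) (toℚᵘ-fromℚᵘ (mkℚᵘ (ℤ.+ suc n) 0)) ⟩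
  mkℚᵘ i n ℚᵘ.* mkℚᵘ (ℤ.+ suc n) 0                ≈⟨ *≡* (trans (ℤₚ.*-assoc i (ℤ.+ suc n) (ℤ.+ 1)) (cong (λ d → i ℤ.* ℤ.+ d) (trans (ℕₚ.*-identityʳ (suc n)) (sym (ℕₚ.*-identityʳ (suc n)))))) ⟩
  mkℚᵘ i 0                                      ≈⟨ toℚᵘ-fromℚᵘ (mkℚᵘ i 0) ⟨
  toℚᵘ (ℤtoℚ i)                                 ∎)

open ≡-Reasoning

ℕtoℚ-+ : ∀ m n → ℕtoℚ (m ℕ.+ n) ≡ ℕtoℚ m + ℕtoℚ n
ℕtoℚ-+ m n = ℤtoℚ-+ (ℤ.+ m) (ℤ.+ n)

ℕtoℚ-* : ∀ m n → ℕtoℚ (m ℕ.* n) ≡ ℕtoℚ m * ℕtoℚ n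
ℕtoℚ-* m n = trans (cong ℤtoℚ (ℤₚ.pos-* m n)) (ℤtoℚ-* (ℤ.+ m) (ℤ.+ n))

ℕtoℚ-suc : ∀ n → ℕtoℚ (suc n) ≡ 1ℚ + ℕtoℚ n
ℕtoℚ-suc = ℕtoℚ-+ 1

*-cancelˡ-ℕtoℚ : ∀ n .{{_ : ℕ.NonZero n}} {x y} → ℕtoℚ n * x ≡ ℕtoℚ n * y → x ≡ y
*-cancelˡ-ℕtoℚ n {x} {y} eq = trans (sym (recover x)) (trans (cong ((ℤ.+ 1 / n) *_) eq) (recover y))
  where
  recover : ∀ z → (ℤ.+ 1 / n) * (ℕtoℚ n * z) ≡ z
  recover z = begin
    (ℤ.+ 1 / n) * (ℕtoℚ n * z)   ≡⟨ ℚₚ.*-assoc (ℤ.+ 1 / n) (ℕtoℚ n) z ⟨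
    (ℤ.+ 1 / n) * ℕtoℚ n * z     ≡⟨ cong (_* z) (/-cancelʳ (ℤ.+ 1) n) ⟩
    1ℚ * z                     ≡⟨ ℚₚ.*-identityˡ z ⟩
    z                          ∎

invFact-inverse : ∀ r → invFact r * ℕtoℚ (r !) ≡ 1ℚ
invFact-inverse r = /-cancelʳ (ℤ.+ 1) (r !) {{r ℕₚ.!≢0}}

invFact-suc : ∀ r → ℕtoℚ (suc r) * invFact (suc r) ≡ invFact r
invFact-suc r = *-cancelˡ-ℕtoℚ (r !) {{r ℕₚ.!≢0}} (begin
  ℕtoℚ (r !) * (ℕtoℚ (suc r) * invFact (suc r))   ≡⟨ regroup (ℕtoℚ (r !)) (ℕtoℚ (suc r)) (invFact (suc r)) ⟩
  invFact (suc r) * (ℕtoℚ (suc r) * ℕtoℚ (r !))   ≡⟨ cong (invFact (suc r) *_) (ℕtoℚ-* (suc r) (r !)) ⟨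
  invFact (suc r) * ℕtoℚ (suc r !)                ≡⟨ invFact-inverse (suc r) ⟩
  1ℚ                                              ≡⟨ invFact-inverse r ⟨
  invFact r * ℕtoℚ (r !)                          ≡⟨ ℚₚ.*-comm (invFact r) (ℕtoℚ (r !)) ⟩
  ℕtoℚ (r !) * invFact r                          ∎)
  where
  regroup : ∀ a b c → a * (b * c) ≡ c * (b * a)
  regroup = solve-∀ ℚ-ring

-- Finite sums indexed from 1.

sumTo-cong : ∀ {f g} m → (∀ k → 1 ℕ.≤ k → k ℕ.≤ m → f k ≡ g k) → sumTo m f ≡ sumTo m g
sumTo-cong zero eq = refl
sumTo-cong (suc m) eq =
  cong₂ _+_ (sumTo-cong m λ k 1≤k k≤m → eq k 1≤k (ℕₚ.m≤n⇒m≤1+n k≤m)) (eq (suc m) (s≤s z≤n) ℕₚ.≤-refl)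

sumTo-zero : ∀ m → sumTo m (λ _ → 0ℚ) ≡ 0ℚ
sumTo-zero zero = refl
sumTo-zero (suc m) = trans (ℚₚ.+-identityʳ _) (sumTo-zero m)

sumTo-+ : ∀ m f g → sumTo m (λ k → f k + g k) ≡ sumTo m f + sumTo m g
sumTo-+ zero f g = refl
sumTo-+ (suc m) f g = trans (cong (_+ (f (suc m) + g (suc m))) (sumTo-+ m f g)) (interchange (sumTo m f) (sumTo m g) (f (suc m)) (g (suc m)))
  where
  interchange : ∀ a b c d → a + b + (c + d) ≡ a + c + (b + d)
  interchange = solve-∀ ℚ-ring

sumTo-* : ∀ m c f → sumTo m (λ k → c * f k) ≡ c * sumTo m f
sumTo-* zero c f = sym (ℚₚ.*-zeroʳ c)
sumTo-* (suc m) c f = trans (cong (_+ c * f (suc m)) (sumTo-* m c f)) (sym (ℚₚ.*-distribˡ-+ c (sumTo m f) (f (suc m))))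

sumTo-first : ∀ m f → sumTo (suc m) f ≡ f 1 + sumTo m (f ∘ suc)
sumTo-first zero f = ℚₚ.+-comm 0ℚ (f 1)
sumTo-first (suc m) f = trans (cong (_+ f (2 ℕ.+ m)) (sumTo-first m f)) (ℚₚ.+-assoc (f 1) _ _)

-- Formal power series, given by their coefficients.

δ : ℕ → ℚ
δ zero = 1ℚ
δ (suc _) = 0ℚ

shift : ℕ → (ℕ → ℚ) → ℕ → ℚ
shift zero f k = f k
shift (suc r) f zero = 0ℚ
shift (suc r) f (suc k) = shift r f k

shift-+ : ∀ r s f k → shift r (shift s f) k ≡ shift (r ℕ.+ s) f k
shift-+ zero s f k = refl
shift-+ (suc r) s f zero = refl
shift-+ (suc r) s f (suc k) = shift-+ r s f k

shift-comm : ∀ r s f k → shift r (shift s f) k ≡ shift s (shift r f) k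
shift-comm r s f k = begin
  shift r (shift s f) k   ≡⟨ shift-+ r s f k ⟩
  shift (r ℕ.+ s) f k     ≡⟨ cong (λ n → shift n f k) (ℕₚ.+-comm r s) ⟩
  shift (s ℕ.+ r) f k     ≡⟨ shift-+ s r f k ⟨
  shift s (shift r f) k   ∎

shift-< : ∀ r f k → k ℕ.< r → shift r f k ≡ 0ℚ
shift-< (suc r) f zero k<r = refl
shift-< (suc r) f (suc k) (s≤s k<r) = shift-< r f k k<r

shift-cong : ∀ r {f g} k → (∀ i → i ℕ.≤ k → f i ≡ g i) → shift r f k ≡ shift r g k
shift-cong zero k eq = eq k ℕₚ.≤-refl
shift-cong (suc r) zero eq = refl
shift-cong (suc r) (suc k) eq = shift-cong r k λ i i≤k → eq i (ℕₚ.m≤n⇒m≤1+n i≤k)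

shift-linear : ∀ r f c g k → shift r (λ i → f i + c * g i) k ≡ shift r f k + c * shift r g k
shift-linear zero f c g k = refl
shift-linear (suc r) f c g zero = sym (trans (ℚₚ.+-identityˡ (c * 0ℚ)) (ℚₚ.*-zeroʳ c))
shift-linear (suc r) f c g (suc k) = shift-linear r f c g k

shift-0 : ∀ r k → shift r (λ _ → 0ℚ) k ≡ 0ℚ
shift-0 zero k = refl
shift-0 (suc r) zero = refl
shift-0 (suc r) (suc k) = shift-0 r k

-- The operator t·d/dt on series.
θ : (ℕ → ℚ) → ℕ → ℚ
θ f k = ℕtoℚ k * f k

-- Leibniz rule for t^r f, since t·d/dt multiplies t^r by r.
θ-shift : ∀ r f k → θ (shift r f) k ≡ shift r (θ f) k + ℕtoℚ r * shift r f k
θ-shift zero f k = sym (trans (cong (θ f k +_) (ℚₚ.*-zeroˡ (f k))) (ℚₚ.+-identityʳ (θ f k)))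
θ-shift (suc r) f zero = sym (trans (ℚₚ.+-identityˡ _) (trans (ℚₚ.*-zeroʳ (ℕtoℚ (suc r))) (sym (ℚₚ.*-zeroˡ 0ℚ))))
θ-shift (suc r) f (suc k) = begin
  ℕtoℚ (suc k) * s                        ≡⟨ cong (_* s) (ℕtoℚ-suc k) ⟩
  (1ℚ + ℕtoℚ k) * s                       ≡⟨ split (ℕtoℚ k) s ⟩
  ℕtoℚ k * s + s                          ≡⟨ cong (_+ s) (θ-shift r f k) ⟩
  shift r (θ f) k + ℕtoℚ r * s + s        ≡⟨ merge (shift r (θ f) k) (ℕtoℚ r) s ⟩
  shift r (θ f) k + (1ℚ + ℕtoℚ r) * s     ≡⟨ cong (λ c → shift r (θ f) k + c * s) (ℕtoℚ-suc r) ⟨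
  shift r (θ f) k + ℕtoℚ (suc r) * s      ∎
  where
  s = shift r f k
  split : ∀ a b → (1ℚ + a) * b ≡ a * b + b
  split = solve-∀ ℚ-ring
  merge : ∀ a b c → a + b * c + c ≡ a + (1ℚ + b) * c
  merge = solve-∀ ℚ-ring

-- Product of f with the polynomial s_r t^r + … + s_{r+m-1} t^{r+m-1}.
window : (ℕ → ℚ) → ℕ → ℕ → (ℕ → ℚ) → ℕ → ℚ
window s r zero f k = 0ℚ
window s r (suc m) f k = s r * shift r f k + window s (suc r) m f k

-- The polynomial starts at t^1 or later, so coefficient k of the product sees only coefficients of
-- the series strictly below k.
window-cong-< : ∀ s r m {f g} k → (∀ i → i ℕ.< k → f i ≡ g i) →
  window s (suc r) m f k ≡ window s (suc r) m g k
window-cong-< s r zero k eq = refl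
window-cong-< s r (suc m) {f} {g} k eq =
  cong₂ _+_ (cong (s (suc r) *_) (shift-suc k eq)) (window-cong-< s (suc r) m k eq)
  where
  shift-suc : ∀ k → (∀ i → i ℕ.< k → f i ≡ g i) → shift (suc r) f k ≡ shift (suc r) g k
  shift-suc zero eq = refl
  shift-suc (suc k) eq = shift-cong r k λ i i≤k → eq i (s≤s i≤k)

window-cong : ∀ s r m {f g} k → (∀ i → f i ≡ g i) → window s r m f k ≡ window s r m g k
window-cong s r zero k eq = refl
window-cong s r (suc m) k eq =
  cong₂ _+_ (cong (s r *_) (shift-cong r k λ i _ → eq i)) (window-cong s (suc r) m k eq)

window-weights : ∀ {s t} r m f k → (∀ i → s (suc i) ≡ t (suc i)) → window s (suc r) m f k ≡ window t (suc r) m f k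
window-weights r zero f k eq = refl
window-weights r (suc m) f k eq = cong₂ _+_ (cong (_* shift (suc r) f k) (eq r)) (window-weights (suc r) m f k eq)

window-linear : ∀ s r m f c g k →
  window s r m (λ i → f i + c * g i) k ≡ window s r m f k + c * window s r m g k
window-linear s r zero f c g k = sym (trans (ℚₚ.+-identityˡ _) (ℚₚ.*-zeroʳ c))
window-linear s r (suc m) f c g k = begin
  s r * shift r (λ i → f i + c * g i) k + window s (suc r) m (λ i → f i + c * g i) k
    ≡⟨ cong₂ _+_ (cong (s r *_) (shift-linear r f c g k)) (window-linear s (suc r) m f c g k) ⟩
  s r * (F + c * G) + (F′ + c * G′)
    ≡⟨ regroup (s r) F c G F′ G′ ⟩
  s r * F + F′ + c * (s r * G + G′) ∎
  where
  F = shift r f k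
  G = shift r g k
  F′ = window s (suc r) m f k
  G′ = window s (suc r) m g k
  regroup : ∀ a b c d e f → a * (b + c * d) + (e + c * f) ≡ a * b + e + c * (a * d + f)
  regroup = solve-∀ ℚ-ring

window-+ : ∀ s t c r m f k →
  window (λ i → s i + c * t i) r m f k ≡ window s r m f k + c * window t r m f k
window-+ s t c r zero f k = sym (trans (ℚₚ.+-identityˡ _) (ℚₚ.*-zeroʳ c))
window-+ s t c r (suc m) f k =
  trans (cong ((s r + c * t r) * shift r f k +_) (window-+ s t c (suc r) m f k)) (regroup (s r) c (t r) (shift r f k) _ _)
  where
  regroup : ∀ a c b f x y → (a + c * b) * f + (x + c * y) ≡ a * f + x + c * (b * f + y)
  regroup = solve-∀ ℚ-ring

shift-window : ∀ j s r m f k → shift j (window s r m f) k ≡ window s r m (shift j f) k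
shift-window j s r zero f k = shift-0 j k
shift-window j s r (suc m) f k = begin
  shift j (λ i → s r * shift r f i + window s (suc r) m f i) k
    ≡⟨ shift-cong j k (λ i _ → ℚₚ.+-comm (s r * shift r f i) (window s (suc r) m f i)) ⟩
  shift j (λ i → window s (suc r) m f i + s r * shift r f i) k
    ≡⟨ shift-linear j (window s (suc r) m f) (s r) (shift r f) k ⟩
  shift j (window s (suc r) m f) k + s r * shift j (shift r f) k
    ≡⟨ cong₂ _+_ (shift-window j s (suc r) m f k) (cong (s r *_) (shift-comm j r f k)) ⟩
  window s (suc r) m (shift j f) k + s r * shift r (shift j f) k
    ≡⟨ ℚₚ.+-comm (window s (suc r) m (shift j f) k) _ ⟩
  s r * shift r (shift j f) k + window s (suc r) m (shift j f) k ∎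

-- Series with a prescribed logarithmic derivative, up to a given index.

LogDeriv : (ℕ → ℚ) → ℕ → ℕ → (ℕ → ℚ) → ℕ → Set
LogDeriv s r m f b = ∀ k → k ℕ.≤ b → θ f k ≡ window s r m f k

-- Coefficient k of t f′ is k f_k, while the other side involves only lower coefficients; dividing
-- by k gives a recursion. The parameter `n` of `below` turns strong induction into structural
-- induction.
LogDeriv-unique : ∀ s m b {f g} → f 0 ≡ g 0 →
  LogDeriv s 1 m f b → LogDeriv s 1 m g b → ∀ k → k ℕ.≤ b → f k ≡ g k
LogDeriv-unique s m b {f} {g} eq₀ θf θg k k≤b = below (suc k) k ℕₚ.≤-refl k≤b
  where
  below : ∀ n i → i ℕ.< n → i ℕ.≤ b → f i ≡ g i
  below (suc n) zero i<n i≤b = eq₀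
  below (suc n) (suc i) (s≤s i<n) i≤b = *-cancelˡ-ℕtoℚ (suc i) (begin
    θ f (suc i)              ≡⟨ θf (suc i) i≤b ⟩
    window s 1 m f (suc i)   ≡⟨ window-cong-< s 0 m (suc i) (λ j j<i → below n j (ℕₚ.<-≤-trans j<i i<n) (ℕₚ.≤-trans (ℕₚ.<⇒≤ j<i) i≤b)) ⟩
    window s 1 m g (suc i)   ≡⟨ θg (suc i) i≤b ⟨
    θ g (suc i)              ∎)

-- Coefficients of ∏ (1 - q_a t) over 1 ≤ a ≤ N, i.e. (-1)^k e_k(q_1,…,q_N).

linProd : (ℕ → ℚ) → ℕ → ℕ → ℚ
linProd q zero = δ
linProd q (suc N) k = linProd q N k + (- q (suc N)) * shift 1 (linProd q N) k

powerSum : (ℕ → ℚ) → ℕ → ℕ → ℚ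
powerSum q N r = sumTo N (λ a → q a ^Q r)

-- A geometric sum times 1 - a t telescopes to a^r t^r - a^(r+m) t^(r+m); the second monomial cannot
-- reach coefficient k < r + m.
window-geometric : ∀ a f r m k → k ℕ.< r ℕ.+ m →
  window (a ^Q_) r m (λ i → f i + (- a) * shift 1 f i) k ≡ (a ^Q r) * shift r f k
window-geometric a f r zero k k<r =
  sym (trans (cong ((a ^Q r) *_) (shift-< r f k (subst (k ℕ.<_) (ℕₚ.+-identityʳ r) k<r))) (ℚₚ.*-zeroʳ (a ^Q r)))
window-geometric a f r (suc m) k k<r = begin
  (a ^Q r) * shift r (λ i → f i + (- a) * shift 1 f i) k + window (a ^Q_) (suc r) m _ k
    ≡⟨ cong₂ (λ x y → (a ^Q r) * x + y) (shift-linear r f (- a) (shift 1 f) k)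
             (window-geometric a f (suc r) m k (subst (k ℕ.<_) (ℕₚ.+-suc r m) k<r)) ⟩
  (a ^Q r) * (shift r f k + (- a) * shift r (shift 1 f) k) + a * (a ^Q r) * shift (suc r) f k
    ≡⟨ cong (λ x → (a ^Q r) * (shift r f k + (- a) * x) + a * (a ^Q r) * shift (suc r) f k)
            (trans (shift-comm r 1 f k) (shift-+ 1 r f k)) ⟩
  (a ^Q r) * (shift r f k + (- a) * shift (suc r) f k) + a * (a ^Q r) * shift (suc r) f k
    ≡⟨ telescope (a ^Q r) a (shift r f k) (shift (suc r) f k) ⟩
  (a ^Q r) * shift r f k ∎
  where
  telescope : ∀ c a x y → c * (x + (- a) * y) + a * c * y ≡ c * x
  telescope = solve-∀ ℚ-ring

-- Newton's identities as a differential equation. A new factor 1 - a t contributes the extra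
-- summand - a t f by the product rule, and `window-geometric` rewrites a t f as (a t + a² t² + ...)
-- times the enlarged product, which adds a^r to the r-th power sum.
newton : ∀ q N m → LogDeriv (λ r → - powerSum q N r) 1 m (linProd q N) m
newton q zero m k k≤m = trans (θδ k) (sym (windowδ 1 m))
  where
  θδ : ∀ k → θ δ k ≡ 0ℚ
  θδ zero = refl
  θδ (suc k) = ℚₚ.*-zeroʳ (ℕtoℚ (suc k))
  windowδ : ∀ r m → window (λ _ → - 0ℚ) r m δ k ≡ 0ℚ
  windowδ r zero = refl
  windowδ r (suc m) = trans (cong₂ _+_ (ℚₚ.*-zeroˡ (shift r δ k)) (windowδ (suc r) m)) (ℚₚ.+-identityˡ 0ℚ)
newton q (suc N) m k k≤m = begin
  ℕtoℚ k * (f k + (- a) * shift 1 f k)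
    ≡⟨ distrib (ℕtoℚ k) (f k) a (shift 1 f k) ⟩
  θ f k + (- a) * θ (shift 1 f) k
    ≡⟨ cong₂ (λ x y → x + (- a) * y) (newton q N m k k≤m)
         (trans (θ-shift 1 f k) (cong (_+ 1ℚ * shift 1 f k)
           (trans (shift-cong 1 k λ i i≤k → newton q N m i (ℕₚ.≤-trans i≤k k≤m)) (shift-window 1 s 1 m f k)))) ⟩
  window s 1 m f k + (- a) * (window s 1 m (shift 1 f) k + 1ℚ * shift 1 f k)
    ≡⟨ regroup (window s 1 m f k) a (window s 1 m (shift 1 f) k) (shift 1 f k) ⟩
  window s 1 m f k + (- a) * window s 1 m (shift 1 f) k + (- 1ℚ) * (a * 1ℚ * shift 1 f k)
    ≡⟨ cong₂ (λ x y → x + (- 1ℚ) * y) (window-linear s 1 m f (- a) (shift 1 f) k) (window-geometric a f 1 m k (s≤s k≤m)) ⟨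
  window s 1 m g k + (- 1ℚ) * window (a ^Q_) 1 m g k
    ≡⟨ window-+ s (a ^Q_) (- 1ℚ) 1 m g k ⟨
  window (λ r → s r + (- 1ℚ) * (a ^Q r)) 1 m g k
    ≡⟨ window-weights 0 m g k (λ i → neg (powerSum q N (suc i)) (a ^Q suc i)) ⟩
  window (λ r → - powerSum q (suc N) r) 1 m g k ∎
  where
  a = q (suc N)
  f = linProd q N
  g = linProd q (suc N)
  s : ℕ → ℚ
  s r = - powerSum q N r
  distrib : ∀ c x a y → c * (x + (- a) * y) ≡ c * x + (- a) * (c * y)
  distrib = solve-∀ ℚ-ring
  regroup : ∀ x a y z → x + (- a) * (y + 1ℚ * z) ≡ x + (- a) * y + (- 1ℚ) * (a * 1ℚ * z)
  regroup = solve-∀ ℚ-ring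
  neg : ∀ x y → - x + (- 1ℚ) * y ≡ - (x + y)
  neg = solve-∀ ℚ-ring

-- The sum over all exponent vectors, as a product of truncated exponential series.

wt : ∀ {m} → ℕ → Vec ℕ m → ℕ
wt r [] = 0
wt r (j ∷ js) = r ℕ.* j ℕ.+ wt (suc r) js

expCoeff : (ℕ → ℚ) → ℕ → ℕ → ℚ
expCoeff x r j = invFact j * (x r ^Q j)

monomial : (ℕ → ℚ) → ∀ {m} → ℕ → Vec ℕ m → ℚ
monomial x r [] = 1ℚ
monomial x r (j ∷ js) = expCoeff x r j * monomial x (suc r) js

-- A nameable copy of the `range` local to `allVecs`.
countdown : ℕ → List ℕ
countdown zero = zero ∷ []
countdown (suc b) = suc b ∷ countdown b

-- The functions local to `weight`, `bellTerm` and `allVecs` cannot be named; the underscores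
-- below are solved by unification once their arguments are abstracted to distinct variables.
mutual
  weightGo : (n : ℕ) (u : Vec ℕ n) (r k : ℕ) (v : Vec ℕ k) → ℕ
  weightGo = _

  weight≡wt : ∀ {m} (v : Vec ℕ m) → weight v ≡ wt 1 v
  weight≡wt [] = refl
  weight≡wt {suc m} (j ∷ js) with suc m | j ∷ js | 2
  ... | n | u | r = cong (1 ℕ.* j ℕ.+_) (weightGo≡wt n u r m js)

  weightGo≡wt : ∀ n u r k v → weightGo n u r k v ≡ wt r v
  weightGo≡wt n u r zero [] = refl
  weightGo≡wt n u r (suc k) (j ∷ js) = cong (r ℕ.* j ℕ.+_) (weightGo≡wt n u (suc r) k js)

module _ (k : ℕ) (y : ℕ → ℚ) where
  private
    x : ℕ → ℚ
    x r = y r * invFact r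

  mutual
    bellGo : (n : ℕ) (u : Vec ℕ n) (r l : ℕ) (v : Vec ℕ l) → ℚ
    bellGo = _

    bellTerm≡ : ∀ {m} (v : Vec ℕ m) → bellTerm k y v ≡ ℕtoℚ (k !) * monomial x 1 v
    bellTerm≡ [] = refl
    bellTerm≡ {suc m} (j ∷ js) with suc m | j ∷ js | 2
    ... | n | u | r = cong (λ z → ℕtoℚ (k !) * (expCoeff x 1 j * z)) (bellGo≡monomial n u r m js)

    bellGo≡monomial : ∀ n u r l v → bellGo n u r l v ≡ monomial x r v
    bellGo≡monomial n u r zero [] = refl
    bellGo≡monomial n u r (suc l) (j ∷ js) = cong (expCoeff x r j *_) (bellGo≡monomial n u (suc r) l js)

mutual
  rangeGo : (m b c : ℕ) → List ℕ
  rangeGo = _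

  allVecs≡ : ∀ m b → allVecs (suc m) b ≡ concatMap (λ v → map (_∷ v) (countdown b)) (allVecs m b)
  allVecs≡ m zero = refl
  allVecs≡ m (suc c) with suc c
  ... | b = cong (λ l → concatMap (λ v → map (_∷ v) (b ∷ l)) (allVecs m b)) (rangeGo≡ m b c)

  rangeGo≡ : ∀ m b c → rangeGo m b c ≡ countdown c
  rangeGo≡ m b zero = refl
  rangeGo≡ m b (suc c) = cong (suc c ∷_) (rangeGo≡ m b c)

-- Sums over lists, and products with sparse polynomials.

∑ : ∀ {A : Set} → (A → ℚ) → List A → ℚ
∑ f L = sumList (map f L)

∑-cong : ∀ {A : Set} {f g : A → ℚ} L → (∀ a → f a ≡ g a) → ∑ f L ≡ ∑ g L
∑-cong [] eq = refl
∑-cong (a ∷ L) eq = cong₂ _+_ (eq a) (∑-cong L eq)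

∑-+ : ∀ {A : Set} (f g : A → ℚ) L → ∑ (λ a → f a + g a) L ≡ ∑ f L + ∑ g L
∑-+ f g [] = refl
∑-+ f g (a ∷ L) = trans (cong (f a + g a +_) (∑-+ f g L)) (interchange (f a) (g a) (∑ f L) (∑ g L))
  where
  interchange : ∀ a b c d → a + b + (c + d) ≡ a + c + (b + d)
  interchange = solve-∀ ℚ-ring

∑-* : ∀ {A : Set} c (f : A → ℚ) L → ∑ (λ a → c * f a) L ≡ c * ∑ f L
∑-* c f [] = sym (ℚₚ.*-zeroʳ c)
∑-* c f (a ∷ L) = trans (cong (c * f a +_) (∑-* c f L)) (sym (ℚₚ.*-distribˡ-+ c (f a) (∑ f L)))

∑-++ : ∀ {A : Set} (f : A → ℚ) L M → ∑ f (L ++ M) ≡ ∑ f L + ∑ f M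
∑-++ f [] M = sym (ℚₚ.+-identityˡ (∑ f M))
∑-++ f (a ∷ L) M = trans (cong (f a +_) (∑-++ f L M)) (sym (ℚₚ.+-assoc (f a) (∑ f L) (∑ f M)))

∑-map : ∀ {A B : Set} (f : B → ℚ) (g : A → B) L → ∑ f (map g L) ≡ ∑ (f ∘ g) L
∑-map f g [] = refl
∑-map f g (a ∷ L) = cong (f (g a) +_) (∑-map f g L)

shift-add : ∀ r f g k → shift r (λ i → f i + g i) k ≡ shift r f k + shift r g k
shift-add r f g k = begin
  shift r (λ i → f i + g i) k        ≡⟨ shift-cong r k (λ i _ → cong (f i +_) (ℚₚ.*-identityˡ (g i))) ⟨
  shift r (λ i → f i + 1ℚ * g i) k   ≡⟨ shift-linear r f 1ℚ g k ⟩
  shift r f k + 1ℚ * shift r g k     ≡⟨ cong (shift r f k +_) (ℚₚ.*-identityˡ (shift r g k)) ⟩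
  shift r f k + shift r g k          ∎

shift-scaleʳ : ∀ r f c k → shift r (λ i → f i * c) k ≡ shift r f k * c
shift-scaleʳ zero f c k = refl
shift-scaleʳ (suc r) f c zero = sym (ℚₚ.*-zeroˡ c)
shift-scaleʳ (suc r) f c (suc k) = shift-scaleʳ r f c k

-- The product of f with the polynomial whose terms are c_j t^(r j), for j in J.
combine : (ℕ → ℚ) → ℕ → List ℕ → (ℕ → ℚ) → ℕ → ℚ
combine c r J f k = ∑ (λ j → c j * shift (r ℕ.* j) f k) J

-- `combine` is a linear combination of shifts, so every linear operator that commutes with shifts
-- commutes with it. Multiplication by a polynomial and by a power of t are the two instances
-- needed.
combine-comm : (T : (ℕ → ℚ) → ℕ → ℚ) →
  (∀ {f g} k → (∀ i → f i ≡ g i) → T f k ≡ T g k) →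
  (∀ k → T (λ _ → 0ℚ) k ≡ 0ℚ) →
  (∀ f c g k → T (λ i → f i + c * g i) k ≡ T f k + c * T g k) →
  (∀ j f k → shift j (T f) k ≡ T (shift j f) k) →
  ∀ c r J f k → T (combine c r J f) k ≡ combine c r J (T f) k
combine-comm T T-cong T-0 T-linear T-shift c r [] f k = T-0 k
combine-comm T T-cong T-0 T-linear T-shift c r (j ∷ J) f k = begin
  T (λ i → c j * shift (r ℕ.* j) f i + combine c r J f i) k
    ≡⟨ T-cong k (λ i → ℚₚ.+-comm (c j * shift (r ℕ.* j) f i) (combine c r J f i)) ⟩
  T (λ i → combine c r J f i + c j * shift (r ℕ.* j) f i) k
    ≡⟨ T-linear (combine c r J f) (c j) (shift (r ℕ.* j) f) k ⟩
  T (combine c r J f) k + c j * T (shift (r ℕ.* j) f) k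
    ≡⟨ cong₂ (λ a b → a + c j * b) (combine-comm T T-cong T-0 T-linear T-shift c r J f k) (sym (T-shift (r ℕ.* j) f k)) ⟩
  combine c r J (T f) k + c j * shift (r ℕ.* j) (T f) k
    ≡⟨ ℚₚ.+-comm (combine c r J (T f) k) _ ⟩
  combine c r (j ∷ J) (T f) k ∎

window-0 : ∀ s r m k → window s r m (λ _ → 0ℚ) k ≡ 0ℚ
window-0 s r zero k = refl
window-0 s r (suc m) k = trans
  (cong₂ _+_ (trans (cong (s r *_) (shift-0 r k)) (ℚₚ.*-zeroʳ (s r))) (window-0 s (suc r) m k))
  (ℚₚ.+-identityˡ 0ℚ)

window-combine : ∀ s r′ m c r J f k →
  window s r′ m (combine c r J f) k ≡ combine c r J (window s r′ m f) k
window-combine s r′ m = combine-comm (window s r′ m)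
  (window-cong s r′ m) (window-0 s r′ m) (window-linear s r′ m) (λ j → shift-window j s r′ m)

shift-combine : ∀ a c r J f k → shift a (combine c r J f) k ≡ combine c r J (shift a f) k
shift-combine a = combine-comm (shift a)
  (λ k eq → shift-cong a k (λ i _ → eq i)) (shift-0 a) (shift-linear a) (λ j → shift-comm j a)

-- Products of truncated exponentials and their logarithmic derivative.

module ExpProduct (x : ℕ → ℚ) (b : ℕ) where

  s : ℕ → ℚ
  s r = ℕtoℚ r * x r

  -- Here `shift (wt r v) δ` is the monomial t^(wt r v), so a sum over all vectors sorts itself by
  -- weight.
  vecTerm : ∀ {m} → ℕ → ℕ → Vec ℕ m → ℚ
  vecTerm r k v = shift (wt r v) δ k * monomial x r v

  -- Coefficients of exp (x_r t^r + … + x_{r+m-1} t^{r+m-1}), correct up to index b.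
  expProd : ℕ → ℕ → ℕ → ℚ
  expProd r m k = ∑ (vecTerm r k) (allVecs m b)

  vecTerm-∷ : ∀ {m} r k j (v : Vec ℕ m) →
    vecTerm r k (j ∷ v) ≡ expCoeff x r j * shift (r ℕ.* j) (λ i → vecTerm (suc r) i v) k
  vecTerm-∷ r k j v = begin
    shift (r ℕ.* j ℕ.+ w) δ k * (c * μ)          ≡⟨ cong (_* (c * μ)) (shift-+ (r ℕ.* j) w δ k) ⟨
    shift (r ℕ.* j) (shift w δ) k * (c * μ)      ≡⟨ regroup (shift (r ℕ.* j) (shift w δ) k) c μ ⟩
    c * (shift (r ℕ.* j) (shift w δ) k * μ)      ≡⟨ cong (c *_) (shift-scaleʳ (r ℕ.* j) (shift w δ) μ k) ⟨
    c * shift (r ℕ.* j) (λ i → shift w δ i * μ) k ∎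
    where
    w = wt (suc r) v
    c = expCoeff x r j
    μ = monomial x (suc r) v
    regroup : ∀ a b c → a * (b * c) ≡ b * (a * c)
    regroup = solve-∀ ℚ-ring

  ∑-concatMap : ∀ {m} r k J (L : List (Vec ℕ m)) →
    ∑ (vecTerm r k) (concatMap (λ v → map (_∷ v) J) L) ≡
    combine (expCoeff x r) r J (λ i → ∑ (vecTerm (suc r) i) L) k
  ∑-concatMap r k J [] = sym (begin
    ∑ (λ j → c j * shift (r ℕ.* j) (λ _ → 0ℚ) k) J
      ≡⟨ ∑-cong J (λ j → trans (cong (c j *_) (shift-0 (r ℕ.* j) k)) (trans (ℚₚ.*-zeroʳ (c j)) (sym (ℚₚ.*-zeroˡ 0ℚ)))) ⟩
    ∑ (λ _ → 0ℚ * 0ℚ) J   ≡⟨ ∑-* 0ℚ (λ _ → 0ℚ) J ⟩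
    0ℚ * ∑ (λ _ → 0ℚ) J   ≡⟨ ℚₚ.*-zeroˡ (∑ (λ _ → 0ℚ) J) ⟩
    0ℚ                    ∎)
    where c = expCoeff x r
  ∑-concatMap r k J (v ∷ L) = begin
    ∑ (vecTerm r k) (map (_∷ v) J ++ concatMap (λ v → map (_∷ v) J) L)
      ≡⟨ ∑-++ (vecTerm r k) (map (_∷ v) J) _ ⟩
    ∑ (vecTerm r k) (map (_∷ v) J) + ∑ (vecTerm r k) (concatMap (λ v → map (_∷ v) J) L)
      ≡⟨ cong₂ _+_ (trans (∑-map (vecTerm r k) (_∷ v) J) (∑-cong J (λ j → vecTerm-∷ r k j v))) (∑-concatMap r k J L) ⟩
    combine c r J (λ i → vecTerm (suc r) i v) k + combine c r J (λ i → ∑ (vecTerm (suc r) i) L) k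
      ≡⟨ ∑-+ _ _ J ⟨
    ∑ (λ j → c j * shift (r ℕ.* j) (λ i → vecTerm (suc r) i v) k + c j * shift (r ℕ.* j) (λ i → ∑ (vecTerm (suc r) i) L) k) J
      ≡⟨ ∑-cong J (λ j → trans (cong (c j *_) (shift-add (r ℕ.* j) _ _ k)) (ℚₚ.*-distribˡ-+ (c j) _ _)) ⟨
    combine c r J (λ i → ∑ (vecTerm (suc r) i) (v ∷ L)) k ∎
    where c = expCoeff x r

  expProd-suc : ∀ r m k → expProd r (suc m) k ≡ combine (expCoeff x r) r (countdown b) (expProd (suc r) m) k
  expProd-suc r m k = trans (cong (∑ (vecTerm r k)) (allVecs≡ m b)) (∑-concatMap r k (countdown b) (allVecs m b))

  expCoeff-suc : ∀ r j → ℕtoℚ (suc j) * expCoeff x r (suc j) ≡ x r * expCoeff x r j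
  expCoeff-suc r j = begin
    ℕtoℚ (suc j) * (invFact (suc j) * (x r * (x r ^Q j)))   ≡⟨ regroup (ℕtoℚ (suc j)) (invFact (suc j)) (x r) (x r ^Q j) ⟩
    x r * (ℕtoℚ (suc j) * invFact (suc j) * (x r ^Q j))     ≡⟨ cong (λ z → x r * (z * (x r ^Q j))) (invFact-suc j) ⟩
    x r * (invFact j * (x r ^Q j))                          ∎
    where
    regroup : ∀ a b c d → a * (b * (c * d)) ≡ c * (a * b * d)
    regroup = solve-∀ ℚ-ring

  -- Differentiating the exponential series cut off at exponent n gives r x_r t^r times the series
  -- cut off at n - 1. Adding the missing top term on the left lets the same cut-off n appear on
  -- both sides and makes the induction go through.
  θ-exp : ∀ r f k n →
    ∑ (λ j → expCoeff x r j * (ℕtoℚ (r ℕ.* j) * shift (r ℕ.* j) f k)) (countdown n)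
      + s r * (expCoeff x r n * shift (r ℕ.* n) (shift r f) k)
    ≡ s r * combine (expCoeff x r) r (countdown n) (shift r f) k
  θ-exp r f k zero = begin
    c 0 * (ℕtoℚ (r ℕ.* 0) * shift (r ℕ.* 0) f k) + 0ℚ + s r * z
      ≡⟨ cong (λ i → c 0 * (ℕtoℚ i * shift (r ℕ.* 0) f k) + 0ℚ + s r * z) (ℕₚ.*-zeroʳ r) ⟩
    c 0 * (0ℚ * shift (r ℕ.* 0) f k) + 0ℚ + s r * z
      ≡⟨ cancel (c 0) (shift (r ℕ.* 0) f k) (s r) z ⟩
    s r * (z + 0ℚ) ∎
    where
    c = expCoeff x r
    z = c 0 * shift (r ℕ.* 0) (shift r f) k
    cancel : ∀ a b c d → a * (0ℚ * b) + 0ℚ + c * d ≡ c * (d + 0ℚ)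
    cancel = solve-∀ ℚ-ring
  θ-exp r f k (suc n) = begin
    c (suc n) * (ℕtoℚ (r ℕ.* suc n) * shift (r ℕ.* suc n) f k) + A + s r * z
      ≡⟨ cong (λ y → y + A + s r * z) head ⟩
    s r * (c n * shift (r ℕ.* n) (shift r f) k) + A + s r * z
      ≡⟨ cong (_+ s r * z) (ℚₚ.+-comm (s r * (c n * shift (r ℕ.* n) (shift r f) k)) A) ⟩
    A + s r * (c n * shift (r ℕ.* n) (shift r f) k) + s r * z
      ≡⟨ cong (_+ s r * z) (θ-exp r f k n) ⟩
    s r * B + s r * z
      ≡⟨ factor (s r) B z ⟩
    s r * (z + B) ∎
    where
    c = expCoeff x r
    z = c (suc n) * shift (r ℕ.* suc n) (shift r f) k
    A = ∑ (λ j → c j * (ℕtoℚ (r ℕ.* j) * shift (r ℕ.* j) f k)) (countdown n)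
    B = combine c r (countdown n) (shift r f) k
    factor : ∀ a b c → a * b + a * c ≡ a * (c + b)
    factor = solve-∀ ℚ-ring
    regroup₁ : ∀ a b c d → a * (b * c * d) ≡ b * (c * a) * d
    regroup₁ = solve-∀ ℚ-ring
    regroup₂ : ∀ a b c d → a * (b * c) * d ≡ a * b * (c * d)
    regroup₂ = solve-∀ ℚ-ring
    head : c (suc n) * (ℕtoℚ (r ℕ.* suc n) * shift (r ℕ.* suc n) f k) ≡ s r * (c n * shift (r ℕ.* n) (shift r f) k)
    head = begin
      c (suc n) * (ℕtoℚ (r ℕ.* suc n) * shift (r ℕ.* suc n) f k)
        ≡⟨ cong₂ (λ y w → c (suc n) * (y * w)) (ℕtoℚ-* r (suc n))
             (trans (cong (λ i → shift i f k) (trans (ℕₚ.*-suc r n) (ℕₚ.+-comm r (r ℕ.* n)))) (sym (shift-+ (r ℕ.* n) r f k))) ⟩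
      c (suc n) * (ℕtoℚ r * ℕtoℚ (suc n) * shift (r ℕ.* n) (shift r f) k)
        ≡⟨ regroup₁ (c (suc n)) (ℕtoℚ r) (ℕtoℚ (suc n)) _ ⟩
      ℕtoℚ r * (ℕtoℚ (suc n) * c (suc n)) * shift (r ℕ.* n) (shift r f) k
        ≡⟨ cong (λ y → ℕtoℚ r * y * shift (r ℕ.* n) (shift r f) k) (expCoeff-suc r n) ⟩
      ℕtoℚ r * (x r * c n) * shift (r ℕ.* n) (shift r f) k
        ≡⟨ regroup₂ (ℕtoℚ r) (x r) (c n) _ ⟩
      s r * (c n * shift (r ℕ.* n) (shift r f) k) ∎

  -- Product rule, one factor at a time: `left` differentiates the remaining factors, `right` the
  -- leading exponential. The truncation error has degree at least r′ (b + 1), which exceeds b, so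
  -- it is invisible up to index b.
  expProd-logDeriv : ∀ r m → LogDeriv s (suc r) m (expProd (suc r) m) b
  expProd-logDeriv r zero zero k≤b = ℚₚ.*-zeroˡ (expProd (suc r) 0 0)
  expProd-logDeriv r zero (suc k) k≤b = ℚₚ.*-zeroʳ (ℕtoℚ (suc k))
  expProd-logDeriv r (suc m) k k≤b = begin
    ℕtoℚ k * g k
      ≡⟨ cong (ℕtoℚ k *_) (expProd-suc r′ m k) ⟩
    ℕtoℚ k * combine c r′ J f k
      ≡⟨ ∑-* (ℕtoℚ k) _ J ⟨
    ∑ (λ j → ℕtoℚ k * (c j * shift (r′ ℕ.* j) f k)) J
      ≡⟨ ∑-cong J (λ j → trans (swap (ℕtoℚ k) (c j) _)
           (trans (cong (c j *_) (θ-shift (r′ ℕ.* j) f k)) (ℚₚ.*-distribˡ-+ (c j) _ _))) ⟩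
    ∑ (λ j → c j * shift (r′ ℕ.* j) (θ f) k + c j * (ℕtoℚ (r′ ℕ.* j) * shift (r′ ℕ.* j) f k)) J
      ≡⟨ ∑-+ _ _ J ⟩
    combine c r′ J (θ f) k + ∑ (λ j → c j * (ℕtoℚ (r′ ℕ.* j) * shift (r′ ℕ.* j) f k)) J
      ≡⟨ cong₂ _+_ left right ⟩
    window s (suc r′) m g k + s r′ * shift r′ g k
      ≡⟨ ℚₚ.+-comm (window s (suc r′) m g k) _ ⟩
    window s r′ (suc m) g k ∎
    where
    r′ = suc r
    c = expCoeff x r′
    J = countdown b
    f = expProd (suc r′) m
    g = expProd r′ (suc m)
    swap : ∀ a b c → a * (b * c) ≡ b * (a * c)
    swap = solve-∀ ℚ-ring
    left : combine c r′ J (θ f) k ≡ window s (suc r′) m g k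
    left = begin
      combine c r′ J (θ f) k
        ≡⟨ ∑-cong J (λ j → cong (c j *_) (shift-cong (r′ ℕ.* j) k λ i i≤k → expProd-logDeriv r′ m i (ℕₚ.≤-trans i≤k k≤b))) ⟩
      combine c r′ J (window s (suc r′) m f) k
        ≡⟨ window-combine s (suc r′) m c r′ J f k ⟨
      window s (suc r′) m (combine c r′ J f) k
        ≡⟨ window-cong s (suc r′) m k (expProd-suc r′ m) ⟨
      window s (suc r′) m g k ∎
    overflow : shift (r′ ℕ.* b) (shift r′ f) k ≡ 0ℚ
    overflow = trans (shift-+ (r′ ℕ.* b) r′ f k) (shift-< (r′ ℕ.* b ℕ.+ r′) f k
      (ℕₚ.≤-<-trans k≤b (ℕₚ.≤-<-trans (ℕₚ.m≤n*m b r′) (ℕₚ.m<m+n (r′ ℕ.* b) (s≤s z≤n)))))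
    right : ∑ (λ j → c j * (ℕtoℚ (r′ ℕ.* j) * shift (r′ ℕ.* j) f k)) J ≡ s r′ * shift r′ g k
    right = begin
      ∑ (λ j → c j * (ℕtoℚ (r′ ℕ.* j) * shift (r′ ℕ.* j) f k)) J
        -- The top term that `θ-exp` expects is a multiple of the vanishing `overflow`, so it enters
        -- as a zero.
        ≡⟨ pad _ (s r′) (c b) ⟨
      ∑ (λ j → c j * (ℕtoℚ (r′ ℕ.* j) * shift (r′ ℕ.* j) f k)) J + s r′ * (c b * 0ℚ)
        ≡⟨ cong (λ y → ∑ (λ j → c j * (ℕtoℚ (r′ ℕ.* j) * shift (r′ ℕ.* j) f k)) J + s r′ * (c b * y)) overflow ⟨
      _ ≡⟨ θ-exp r′ f k b ⟩
      s r′ * combine c r′ J (shift r′ f) k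
        ≡⟨ cong (s r′ *_) (trans (shift-cong r′ k λ i _ → expProd-suc r′ m i) (shift-combine r′ c r′ J f k)) ⟨
      s r′ * shift r′ g k ∎
      where
      pad : ∀ a b c → a + b * (c * 0ℚ) ≡ a
      pad = solve-∀ ℚ-ring

-- Bell polynomials as coefficients of an exponential.

size≤wt : ∀ {m} r (v : Vec ℕ m) → size v ℕ.≤ wt (suc r) v
size≤wt r [] = z≤n
size≤wt r (j ∷ js) = ℕₚ.+-mono-≤ (ℕₚ.m≤n*m j (suc r)) (size≤wt (suc r) js)

size≡0⇒wt≡0 : ∀ {m} r (v : Vec ℕ m) → size v ≡ 0 → wt r v ≡ 0
size≡0⇒wt≡0 r [] eq = refl
size≡0⇒wt≡0 r (zero ∷ js) eq = cong₂ ℕ._+_ (ℕₚ.*-zeroʳ r) (size≡0⇒wt≡0 (suc r) js eq)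

shift-δ-diag : ∀ r → shift r δ r ≡ 1ℚ
shift-δ-diag zero = refl
shift-δ-diag (suc r) = shift-δ-diag r

shift-δ-off : ∀ r k → r ≢ k → shift r δ k ≡ 0ℚ
shift-δ-off zero zero r≢k = ⊥-elim (r≢k refl)
shift-δ-off zero (suc k) r≢k = refl
shift-δ-off (suc r) zero r≢k = refl
shift-δ-off (suc r) (suc k) r≢k = shift-δ-off r k (r≢k ∘ cong suc)

sumTo-indicator : ∀ k s t → 1 ℕ.≤ s → s ℕ.≤ k →
  sumTo k (λ i → if does (s ℕ.≟ i) then t else 0ℚ) ≡ t
sumTo-indicator zero (suc s) t 1≤s ()
sumTo-indicator (suc k) s t 1≤s s≤1+k with s ℕ.≟ suc k
... | yes s≡1+k = trans
  (cong₂ _+_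
    (trans
      (sumTo-cong k λ i _ i≤k → cong (λ d → if d then t else 0ℚ)
        (dec-false (s ℕ.≟ i) (λ s≡i → ℕₚ.<⇒≢ (s≤s i≤k) (trans (sym s≡i) s≡1+k))))
      (sumTo-zero k))
    (cong (λ d → if d then t else 0ℚ) (dec-true (s ℕ.≟ suc k) s≡1+k)))
  (ℚₚ.+-identityˡ t)
... | no s≢1+k = trans
  (trans (cong (λ d → earlier + (if d then t else 0ℚ)) (dec-false (s ℕ.≟ suc k) s≢1+k)) (ℚₚ.+-identityʳ earlier))
  (sumTo-indicator k s t 1≤s (ℕₚ.≤-pred (ℕₚ.≤∧≢⇒< s≤1+k s≢1+k)))
  where earlier = sumTo k (λ i → if does (s ℕ.≟ i) then t else 0ℚ)

module _ {A : Set} {P : A → Set} (P? : ∀ a → Dec (P a)) where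

  ∑-filter-∷ : ∀ f a L → ∑ f (filter P? (a ∷ L)) ≡ (if does (P? a) then f a else 0ℚ) + ∑ f (filter P? L)
  ∑-filter-∷ f a L with does (P? a)
  ... | true = refl
  ... | false = sym (ℚₚ.+-identityˡ (∑ f (filter P? L)))

hasType? : ∀ {m} (k i : ℕ) (v : Vec ℕ m) → Dec (weight v ≡ k × size v ≡ i)
hasType? k i v = (weight v ℕ.≟ k) ×-dec (size v ℕ.≟ i)

-- A vector of weight `suc k` has its size between 1 and `suc k`, so exactly one index i counts it;
-- summing over i merely drops the size condition. Weight 0 must be excluded: the zero vector has
-- size 0, which the sum from 1 misses.
∑-size : ∀ {m} k (v : Vec ℕ m) t →
  sumTo (suc k) (λ i → if does (hasType? (suc k) i v) then t else 0ℚ) ≡ shift (wt 1 v) δ (suc k) * t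
∑-size k v t with weight v ℕ.≟ suc k
... | no w≢ = begin
  sumTo (suc k) (λ i → if does (hasType? (suc k) i v) then t else 0ℚ)
    ≡⟨ sumTo-cong (suc k) (λ i _ _ → cong (λ d → if d then t else 0ℚ) (dec-false (hasType? (suc k) i v) (w≢ ∘ proj₁))) ⟩
  sumTo (suc k) (λ _ → 0ℚ)   ≡⟨ sumTo-zero (suc k) ⟩
  0ℚ                         ≡⟨ ℚₚ.*-zeroˡ t ⟨
  0ℚ * t                     ≡⟨ cong (_* t) (shift-δ-off (wt 1 v) (suc k) (w≢ ∘ trans (weight≡wt v))) ⟨
  shift (wt 1 v) δ (suc k) * t ∎
... | yes w≡ = begin
  sumTo (suc k) (λ i → if does (hasType? (suc k) i v) then t else 0ℚ)
    ≡⟨ sumTo-cong (suc k) (λ i _ _ → cong (λ d → if d ∧ does (size v ℕ.≟ i) then t else 0ℚ) (dec-true (weight v ℕ.≟ suc k) w≡)) ⟩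
  sumTo (suc k) (λ i → if does (size v ℕ.≟ i) then t else 0ℚ)
    ≡⟨ sumTo-indicator (suc k) (size v) t (ℕₚ.n≢0⇒n>0 size≢0) (subst (size v ℕ.≤_) wt≡ (size≤wt 0 v)) ⟩
  t                              ≡⟨ ℚₚ.*-identityˡ t ⟨
  1ℚ * t                         ≡⟨ cong (_* t) (shift-δ-diag (suc k)) ⟨
  shift (suc k) δ (suc k) * t    ≡⟨ cong (λ w → shift w δ (suc k) * t) wt≡ ⟨
  shift (wt 1 v) δ (suc k) * t   ∎
  where
  wt≡ : wt 1 v ≡ suc k
  wt≡ = trans (sym (weight≡wt v)) w≡
  size≢0 : size v ≢ 0
  size≢0 eq with () ← trans (sym wt≡) (size≡0⇒wt≡0 1 v eq)

∑-hasType : ∀ {m} k (f : Vec ℕ m → ℚ) L →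
  sumTo (suc k) (λ i → ∑ f (filter (hasType? (suc k) i) L)) ≡ ∑ (λ v → shift (wt 1 v) δ (suc k) * f v) L
∑-hasType k f [] = sumTo-zero (suc k)
∑-hasType k f (v ∷ L) = begin
  sumTo (suc k) (λ i → ∑ f (filter (hasType? (suc k) i) (v ∷ L)))
    ≡⟨ sumTo-cong (suc k) (λ i _ _ → ∑-filter-∷ (hasType? (suc k) i) f v L) ⟩
  sumTo (suc k) (λ i → (if does (hasType? (suc k) i v) then f v else 0ℚ) + ∑ f (filter (hasType? (suc k) i) L))
    ≡⟨ sumTo-+ (suc k) (λ i → if does (hasType? (suc k) i v) then f v else 0ℚ) (λ i → ∑ f (filter (hasType? (suc k) i) L)) ⟩
  sumTo (suc k) (λ i → if does (hasType? (suc k) i v) then f v else 0ℚ) + sumTo (suc k) (λ i → ∑ f (filter (hasType? (suc k) i) L))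
    ≡⟨ cong₂ _+_ (∑-size k v (f v)) (∑-hasType k f L) ⟩
  ∑ (λ v → shift (wt 1 v) δ (suc k) * f v) (v ∷ L) ∎

-- The exponential formula: B_k / k! is the coefficient of t^k in the exponential of the sum of y_r
-- t^r / r!. The two truncation parameters are those of `allVecs` in `bellPartial`.
bell≡expProd : ∀ (k : ℕ) (y : ℕ → ℚ) → let open ExpProduct (λ r → y r * invFact r) (suc k) in
  bell (suc k) y ≡ ℕtoℚ (suc k !) * expProd 1 (suc k) (suc k)
bell≡expProd k y = begin
  bell (suc k) y
    ≡⟨ ∑-hasType k (bellTerm (suc k) y) L ⟩
  ∑ (λ v → shift (wt 1 v) δ (suc k) * bellTerm (suc k) y v) L
    ≡⟨ ∑-cong L (λ v → trans (cong (shift (wt 1 v) δ (suc k) *_) (bellTerm≡ (suc k) y v)) (swap (shift (wt 1 v) δ (suc k)) (ℕtoℚ (suc k !)) _)) ⟩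
  ∑ (λ v → ℕtoℚ (suc k !) * vecTerm 1 (suc k) v) L
    ≡⟨ ∑-* (ℕtoℚ (suc k !)) (vecTerm 1 (suc k)) L ⟩
  ℕtoℚ (suc k !) * expProd 1 (suc k) (suc k) ∎
  where
  open ExpProduct (λ r → y r * invFact r) (suc k)
  L = allVecs (suc k) (suc k)
  swap : ∀ a b c → a * (b * c) ≡ b * (a * c)
  swap = solve-∀ ℚ-ring

combine-head : ∀ c r f n → combine c (suc r) (countdown n) f 0 ≡ c 0 * f 0
combine-head c r f zero = trans (ℚₚ.+-identityʳ _) (cong (λ i → c 0 * shift i f 0) (ℕₚ.*-zeroʳ r))
combine-head c r f (suc n) = trans (cong₂ _+_ (ℚₚ.*-zeroʳ (c (suc n))) (combine-head c r f n)) (ℚₚ.+-identityˡ _)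

-- All exponents of t are positive, so only the zero vector reaches the constant term. This is the
-- initial value for `LogDeriv-unique`.
expProd-head : ∀ x b r m → ExpProduct.expProd x b (suc r) m 0 ≡ 1ℚ
expProd-head x b r zero = refl
expProd-head x b r (suc m) = begin
  expProd (suc r) (suc m) 0                                          ≡⟨ expProd-suc (suc r) m 0 ⟩
  combine c (suc r) (countdown b) (expProd (suc (suc r)) m) 0        ≡⟨ combine-head c r _ b ⟩
  1ℚ * expProd (suc (suc r)) m 0                                     ≡⟨ ℚₚ.*-identityˡ _ ⟩
  expProd (suc (suc r)) m 0                                          ≡⟨ expProd-head x b (suc r) m ⟩
  1ℚ                                                                 ∎
  where
  open ExpProduct x b
  c = expCoeff x (suc r)

linProd-head : ∀ q N → linProd q N 0 ≡ 1ℚ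
linProd-head q zero = refl
linProd-head q (suc N) = trans (cong₂ _+_ (linProd-head q N) (ℚₚ.*-zeroʳ (- q (suc N)))) (ℚₚ.+-identityʳ 1ℚ)

-- With y_r = -(r-1)! π_r the weight r y_r / r! collapses to - π_r, the weight in `newton`. Both
-- series then satisfy the same equation up to `suc k` with constant term 1, so they agree there.
sigmaHat≡linProd : ∀ q N k → sigmaHat (suc k) (powerSum q N) ≡ ((- 1ℚ) ^Q suc k) * linProd q N (suc k)
sigmaHat≡linProd q N k = begin
  sign * invFact (suc k) * bell (suc k) y
    ≡⟨ cong (sign * invFact (suc k) *_) (bell≡expProd k y) ⟩
  sign * invFact (suc k) * (ℕtoℚ (suc k !) * e)
    ≡⟨ regroup sign (invFact (suc k)) (ℕtoℚ (suc k !)) e ⟩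
  sign * (invFact (suc k) * ℕtoℚ (suc k !) * e)
    ≡⟨ cong (λ z → sign * (z * e)) (invFact-inverse (suc k)) ⟩
  sign * (1ℚ * e)
    ≡⟨ cong (sign *_) (ℚₚ.*-identityˡ e) ⟩
  sign * e
    ≡⟨ cong (sign *_) (LogDeriv-unique s (suc k) (suc k) (trans (expProd-head x (suc k) 0 (suc k)) (sym (linProd-head q N)))
         (expProd-logDeriv 0 (suc k)) linProd-logDeriv (suc k) ℕₚ.≤-refl) ⟩
  sign * linProd q N (suc k) ∎
  where
  y x : ℕ → ℚ
  y r = - (ℕtoℚ ((r ∸ 1) !) * powerSum q N r)
  x r = y r * invFact r
  open ExpProduct x (suc k)
  sign = (- 1ℚ) ^Q suc k
  e = expProd 1 (suc k) (suc k)
  regroup : ∀ a b c d → a * b * (c * d) ≡ a * (b * c * d)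
  regroup = solve-∀ ℚ-ring
  weight-eq : ∀ i → s (suc i) ≡ - powerSum q N (suc i)
  weight-eq i = begin
    ℕtoℚ (suc i) * (- (ℕtoℚ (i !) * π) * invFact (suc i))   ≡⟨ move (ℕtoℚ (suc i)) (ℕtoℚ (i !)) π (invFact (suc i)) ⟩
    - (ℕtoℚ (suc i) * invFact (suc i) * ℕtoℚ (i !) * π)     ≡⟨ cong (λ z → - (z * ℕtoℚ (i !) * π)) (invFact-suc i) ⟩
    - (invFact i * ℕtoℚ (i !) * π)                          ≡⟨ cong (λ z → - (z * π)) (invFact-inverse i) ⟩
    - (1ℚ * π)                                              ≡⟨ cong -_ (ℚₚ.*-identityˡ π) ⟩
    - π                                                     ∎
    where
    π = powerSum q N (suc i)
    move : ∀ a b c d → a * (- (b * c) * d) ≡ - (a * d * b * c)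
    move = solve-∀ ℚ-ring
  linProd-logDeriv : LogDeriv s 1 (suc k) (linProd q N) (suc k)
  linProd-logDeriv i i≤ = trans (newton q N (suc k) i i≤) (sym (window-weights {s} {λ r → - powerSum q N r} 0 (suc k) (linProd q N) i weight-eq))

-- Evaluating the product of linear factors; equal factors and the binomial theorem.

linProd-> : ∀ q N k → N ℕ.< k → linProd q N k ≡ 0ℚ
linProd-> q zero (suc k) N<k = refl
linProd-> q (suc N) (suc k) (s≤s N<k) = trans
  (cong₂ (λ y z → y + (- q (suc N)) * z) (linProd-> q N (suc k) (ℕₚ.m<n⇒m<1+n N<k)) (linProd-> q N k N<k))
  (trans (ℚₚ.+-identityˡ _) (ℚₚ.*-zeroʳ (- q (suc N))))

prodTo : ℕ → (ℕ → ℚ) → ℚ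
prodTo zero f = 1ℚ
prodTo (suc N) f = prodTo N f * f (suc N)

-- The leading 1 is the constant coefficient, as `sumTo` starts at 1. A new factor appends - a t
-- times the whole old value, including that constant.
linProd-eval : ∀ q t N → 1ℚ + sumTo N (λ k → linProd q N k * (t ^Q k)) ≡ prodTo N (λ a → 1ℚ - q a * t)
linProd-eval q t zero = refl
linProd-eval q t (suc N) = begin
  1ℚ + sumTo (suc N) (λ k → (f k + (- a) * shift 1 f k) * (t ^Q k))
    ≡⟨ cong (1ℚ +_) (sumTo-cong (suc N) λ k _ _ → distrib (f k) a (shift 1 f k) (t ^Q k)) ⟩
  1ℚ + sumTo (suc N) (λ k → f k * (t ^Q k) + (- a) * (shift 1 f k * (t ^Q k)))
    ≡⟨ cong (1ℚ +_) (trans (sumTo-+ (suc N) _ _) (cong₂ _+_ top (sumTo-* (suc N) (- a) _))) ⟩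
  1ℚ + (S + (- a) * sumTo (suc N) (λ k → shift 1 f k * (t ^Q k)))
    ≡⟨ cong (λ z → 1ℚ + (S + (- a) * z)) shifted ⟩
  1ℚ + (S + (- a) * (t * (1ℚ + S)))
    ≡⟨ factor S a t ⟩
  (1ℚ + S) * (1ℚ - a * t)
    ≡⟨ cong (_* (1ℚ - a * t)) (linProd-eval q t N) ⟩
  prodTo N (λ a → 1ℚ - q a * t) * (1ℚ - a * t) ∎
  where
  a = q (suc N)
  f = linProd q N
  S = sumTo N (λ k → f k * (t ^Q k))
  distrib : ∀ x a y p → (x + (- a) * y) * p ≡ x * p + (- a) * (y * p)
  distrib = solve-∀ ℚ-ring
  factor : ∀ S a t → 1ℚ + (S + (- a) * (t * (1ℚ + S))) ≡ (1ℚ + S) * (1ℚ - a * t)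
  factor = solve-∀ ℚ-ring
  top : sumTo (suc N) (λ k → f k * (t ^Q k)) ≡ S
  top = trans (cong (S +_) (trans (cong (_* (t ^Q suc N)) (linProd-> q N (suc N) ℕₚ.≤-refl)) (ℚₚ.*-zeroˡ (t ^Q suc N)))) (ℚₚ.+-identityʳ S)
  pull : ∀ x t p → x * (t * p) ≡ t * (x * p)
  pull = solve-∀ ℚ-ring
  first : ∀ t S → 1ℚ * (t * 1ℚ) + t * S ≡ t * (1ℚ + S)
  first = solve-∀ ℚ-ring
  shifted : sumTo (suc N) (λ k → shift 1 f k * (t ^Q k)) ≡ t * (1ℚ + S)
  shifted = begin
    sumTo (suc N) (λ k → shift 1 f k * (t ^Q k))
      ≡⟨ sumTo-first N _ ⟩
    f 0 * (t * 1ℚ) + sumTo N (λ k → f k * (t * (t ^Q k)))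
      ≡⟨ cong₂ _+_ (cong (_* (t * 1ℚ)) (linProd-head q N)) (trans (sumTo-cong N λ k _ _ → pull (f k) t (t ^Q k)) (sumTo-* N t _)) ⟩
    1ℚ * (t * 1ℚ) + t * S
      ≡⟨ first t S ⟩
    t * (1ℚ + S) ∎

-- With all roots equal the recursion of `linProd` is Pascal's rule, so `linProd-eval` doubles as
-- the binomial theorem.
linProd-const : ∀ z N k → linProd (λ _ → z) N k ≡ ℕtoℚ (N C k) * ((- z) ^Q k)
linProd-const z zero zero = refl
linProd-const z zero (suc k) = sym (ℚₚ.*-zeroˡ ((- z) ^Q suc k))
linProd-const z (suc N) zero = trans (linProd-head (λ _ → z) (suc N)) (cong (λ c → ℕtoℚ c * 1ℚ) (sym (nCk≡1 (suc N))))
  where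
  nCk≡1 : ∀ n → n C 0 ≡ 1
  nCk≡1 n = trans (nCk≡nC[n∸k] {0} {n} z≤n) (nCn≡1 n)
linProd-const z (suc N) (suc k) = begin
  linProd (λ _ → z) N (suc k) + (- z) * linProd (λ _ → z) N k
    ≡⟨ cong₂ (λ u v → u + (- z) * v) (linProd-const z N (suc k)) (linProd-const z N k) ⟩
  ℕtoℚ (N C suc k) * ((- z) * Z) + (- z) * (ℕtoℚ (N C k) * Z)
    ≡⟨ regroup (ℕtoℚ (N C suc k)) (- z) Z (ℕtoℚ (N C k)) ⟩
  (ℕtoℚ (N C k) + ℕtoℚ (N C suc k)) * ((- z) * Z)
    ≡⟨ cong (_* ((- z) * Z)) (ℕtoℚ-+ (N C k) (N C suc k)) ⟨
  ℕtoℚ (N C k ℕ.+ N C suc k) * ((- z) * Z)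
    ≡⟨ cong (λ c → ℕtoℚ c * ((- z) * Z)) (nCk+nC[k+1]≡[n+1]C[k+1] N k) ⟩
  ℕtoℚ (suc N C suc k) * ((- z) * Z) ∎
  where
  Z = (- z) ^Q k
  regroup : ∀ a b c d → a * (b * c) + b * (d * c) ≡ (d + a) * (b * c)
  regroup = solve-∀ ℚ-ring

-- Numerators, powers and binomial coefficients.

ℤtoℚ-injective : ∀ {i j} → ℤtoℚ i ≡ ℤtoℚ j → i ≡ j
ℤtoℚ-injective {i} {j} eq with *≡* i*1≡j*1 ← ℚₚ.fromℚᵘ-injective {mkℚᵘ i 0} {mkℚᵘ j 0} eq =
  trans (sym (ℤₚ.*-identityʳ i)) (trans i*1≡j*1 (ℤₚ.*-identityʳ j))

*-↧ : ∀ x → x * ℕtoℚ (↧ₙ x) ≡ ℤtoℚ (↥ x)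
*-↧ x@(mkℚ _ _ _) = trans (cong (_* ℕtoℚ (↧ₙ x)) (sym (↥p/↧p≡p x))) (/-cancelʳ (↥ x) (↧ₙ x))

^Q-+ : ∀ x m n → x ^Q (m ℕ.+ n) ≡ (x ^Q m) * (x ^Q n)
^Q-+ x zero n = sym (ℚₚ.*-identityˡ (x ^Q n))
^Q-+ x (suc m) n = trans (cong (x *_) (^Q-+ x m n)) (sym (ℚₚ.*-assoc x (x ^Q m) (x ^Q n)))

^Q-distrib-* : ∀ x y n → (x * y) ^Q n ≡ (x ^Q n) * (y ^Q n)
^Q-distrib-* x y zero = refl
^Q-distrib-* x y (suc n) = trans (cong (x * y *_) (^Q-distrib-* x y n)) (interchange x y (x ^Q n) (y ^Q n))
  where
  interchange : ∀ a b c d → a * b * (c * d) ≡ a * c * (b * d)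
  interchange = solve-∀ ℚ-ring

1^Q : ∀ n → 1ℚ ^Q n ≡ 1ℚ
1^Q zero = refl
1^Q (suc n) = trans (ℚₚ.*-identityˡ (1ℚ ^Q n)) (1^Q n)

ℕtoℚ-^ : ∀ m k → ℕtoℚ (m ℕ.^ k) ≡ ℕtoℚ m ^Q k
ℕtoℚ-^ m zero = refl
ℕtoℚ-^ m (suc k) = trans (ℕtoℚ-* m (m ℕ.^ k)) (cong (ℕtoℚ m *_) (ℕtoℚ-^ m k))

prodTo-const : ∀ x n → prodTo n (λ _ → x) ≡ x ^Q n
prodTo-const x zero = refl
prodTo-const x (suc n) = trans (cong (_* x) (prodTo-const x n)) (ℚₚ.*-comm (x ^Q n) x)

binomial : ∀ z t N → (1ℚ - z * t) ^Q N ≡ 1ℚ + sumTo N (λ k → ℕtoℚ (N C k) * ((- z) ^Q k) * (t ^Q k))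
binomial z t N = begin
  (1ℚ - z * t) ^Q N                                         ≡⟨ prodTo-const (1ℚ - z * t) N ⟨
  prodTo N (λ _ → 1ℚ - z * t)                               ≡⟨ linProd-eval (λ _ → z) t N ⟨
  1ℚ + sumTo N (λ k → linProd (λ _ → z) N k * (t ^Q k))     ≡⟨ cong (1ℚ +_) (sumTo-cong N λ k _ _ → cong (_* (t ^Q k)) (linProd-const z N k)) ⟩
  1ℚ + sumTo N (λ k → ℕtoℚ (N C k) * ((- z) ^Q k) * (t ^Q k)) ∎

-- The absorption identity; for a prime upper index it forces p to divide the inner binomial
-- coefficients.
[k+1]*C : ∀ n k → suc k ℕ.* (suc n C suc k) ≡ suc n ℕ.* (n C k)
[k+1]*C zero zero = refl
[k+1]*C zero (suc k) = trans (cong (suc (suc k) ℕ.*_) (k>n⇒nCk≡0 {1} {suc (suc k)} (s≤s (s≤s z≤n)))) (ℕₚ.*-zeroʳ (suc (suc k)))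
[k+1]*C (suc n) zero = begin
  1 ℕ.* (suc (suc n) C 1)   ≡⟨ cong (1 ℕ.*_) (nC1≡n (suc (suc n))) ⟩
  1 ℕ.* suc (suc n)         ≡⟨ ℕₚ.*-comm 1 (suc (suc n)) ⟩
  suc (suc n) ℕ.* 1         ≡⟨ cong (suc (suc n) ℕ.*_) (trans (nCk≡nC[n∸k] {0} {suc n} z≤n) (nCn≡1 (suc n))) ⟨
  suc (suc n) ℕ.* (suc n C 0) ∎
[k+1]*C (suc n) (suc k) = begin
  suc (suc k) ℕ.* (suc (suc n) C suc (suc k))
    ≡⟨ cong (suc (suc k) ℕ.*_) (nCk+nC[k+1]≡[n+1]C[k+1] (suc n) (suc k)) ⟨
  suc (suc k) ℕ.* (c ℕ.+ (suc n C suc (suc k)))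
    ≡⟨ ℕₚ.*-distribˡ-+ (suc (suc k)) c (suc n C suc (suc k)) ⟩
  c ℕ.+ suc k ℕ.* c ℕ.+ suc (suc k) ℕ.* (suc n C suc (suc k))
    ≡⟨ cong₂ (λ x y → c ℕ.+ x ℕ.+ y) ([k+1]*C n k) ([k+1]*C n (suc k)) ⟩
  c ℕ.+ suc n ℕ.* (n C k) ℕ.+ suc n ℕ.* (n C suc k)
    ≡⟨ ℕₚ.+-assoc c (suc n ℕ.* (n C k)) _ ⟩
  c ℕ.+ (suc n ℕ.* (n C k) ℕ.+ suc n ℕ.* (n C suc k))
    ≡⟨ cong (c ℕ.+_) (ℕₚ.*-distribˡ-+ (suc n) (n C k) (n C suc k)) ⟨
  c ℕ.+ suc n ℕ.* ((n C k) ℕ.+ (n C suc k))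
    ≡⟨ cong (λ x → c ℕ.+ suc n ℕ.* x) (nCk+nC[k+1]≡[n+1]C[k+1] n k) ⟩
  suc (suc n) ℕ.* c ∎
  where c = suc n C suc k

-- Finite differences.

Δ : ℕ → (ℕ → ℚ) → ℕ → ℚ
Δ zero f x = f x
Δ (suc n) f x = Δ n f (suc x) - Δ n f x

Δ-linear : ∀ n f c g x → Δ n (λ i → f i + c * g i) x ≡ Δ n f x + c * Δ n g x
Δ-linear zero f c g x = refl
Δ-linear (suc n) f c g x =
  trans (cong₂ _-_ (Δ-linear n f c g (suc x)) (Δ-linear n f c g x))
        (regroup (Δ n f (suc x)) c (Δ n g (suc x)) (Δ n f x) (Δ n g x))
  where
  regroup : ∀ a c b d e → a + c * b - (d + c * e) ≡ a - d + c * (b - e)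
  regroup = solve-∀ ℚ-ring

-- Leibniz rule for a product with the identity, whose differences of order above 1 vanish. It
-- drives the induction on the exponent for differences of powers.
Δ-id* : ∀ n f x → Δ (suc n) (λ i → ℕtoℚ i * f i) x ≡ ℕtoℚ x * Δ (suc n) f x + ℕtoℚ (suc n) * Δ n f (suc x)
Δ-id* zero f x = trans (cong (λ y → y * f (suc x) - ℕtoℚ x * f x) (ℕtoℚ-suc x)) (regroup (ℕtoℚ x) (f (suc x)) (f x))
  where
  regroup : ∀ x a b → (1ℚ + x) * a - x * b ≡ x * (a - b) + 1ℚ * a
  regroup = solve-∀ ℚ-ring
Δ-id* (suc n) f x = begin
  Δ (suc n) (λ i → ℕtoℚ i * f i) (suc x) - Δ (suc n) (λ i → ℕtoℚ i * f i) x
    ≡⟨ cong₂ _-_ (Δ-id* n f (suc x)) (Δ-id* n f x) ⟩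
  ℕtoℚ (suc x) * D′ + ν * a - (X * D + ν * b)
    ≡⟨ cong (λ y → y * D′ + ν * a - (X * D + ν * b)) (ℕtoℚ-suc x) ⟩
  (1ℚ + X) * D′ + ν * a - (X * D + ν * b)
    ≡⟨ regroup X D′ ν a D b ⟩
  X * (D′ - D) + (D′ + ν * (a - b))
    ≡⟨ cong (X * (D′ - D) +_) (trans (merge D′ ν) (cong (_* D′) (sym (ℕtoℚ-suc (suc n))))) ⟩
  X * (D′ - D) + ℕtoℚ (suc (suc n)) * D′ ∎
  where
  X = ℕtoℚ x
  ν = ℕtoℚ (suc n)
  D = Δ (suc n) f x
  D′ = Δ (suc n) f (suc x)
  a = Δ n f (suc (suc x))
  b = Δ n f (suc x)
  regroup : ∀ X D′ ν a D b → (1ℚ + X) * D′ + ν * a - (X * D + ν * b) ≡ X * (D′ - D) + (D′ + ν * (a - b))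
  regroup = solve-∀ ℚ-ring
  merge : ∀ d ν → d + ν * d ≡ (1ℚ + ν) * d
  merge = solve-∀ ℚ-ring

power : ℕ → ℕ → ℚ
power k x = ℕtoℚ x ^Q k

Δ-power-< : ∀ k n x → k ℕ.< n → Δ n (power k) x ≡ 0ℚ
Δ-power-< zero (suc n) x k<n = Δ-1 n x
  where
  Δ-1 : ∀ n x → Δ (suc n) (λ _ → 1ℚ) x ≡ 0ℚ
  Δ-1 zero x = refl
  Δ-1 (suc n) x = cong₂ _-_ (Δ-1 n (suc x)) (Δ-1 n x)
Δ-power-< (suc k) (suc n) x (s≤s k<n) = begin
  Δ (suc n) (power (suc k)) x
    ≡⟨ Δ-id* n (power k) x ⟩
  ℕtoℚ x * Δ (suc n) (power k) x + ℕtoℚ (suc n) * Δ n (power k) (suc x)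
    ≡⟨ cong₂ (λ a b → ℕtoℚ x * a + ℕtoℚ (suc n) * b) (Δ-power-< k (suc n) x (ℕₚ.m<n⇒m<1+n k<n)) (Δ-power-< k n (suc x) k<n) ⟩
  ℕtoℚ x * 0ℚ + ℕtoℚ (suc n) * 0ℚ
    ≡⟨ vanish (ℕtoℚ x) (ℕtoℚ (suc n)) ⟩
  0ℚ ∎
  where
  vanish : ∀ a b → a * 0ℚ + b * 0ℚ ≡ 0ℚ
  vanish = solve-∀ ℚ-ring

Δ-power-! : ∀ n x → Δ n (power n) x ≡ ℕtoℚ (n !)
Δ-power-! zero x = refl
Δ-power-! (suc n) x = begin
  Δ (suc n) (power (suc n)) x
    ≡⟨ Δ-id* n (power n) x ⟩
  ℕtoℚ x * Δ (suc n) (power n) x + ℕtoℚ (suc n) * Δ n (power n) (suc x)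
    ≡⟨ cong₂ (λ a b → ℕtoℚ x * a + ℕtoℚ (suc n) * b) (Δ-power-< n (suc n) x ℕₚ.≤-refl) (Δ-power-! n (suc x)) ⟩
  ℕtoℚ x * 0ℚ + ℕtoℚ (suc n) * ℕtoℚ (n !)
    ≡⟨ trans (cong (_+ ℕtoℚ (suc n) * ℕtoℚ (n !)) (ℚₚ.*-zeroʳ (ℕtoℚ x))) (ℚₚ.+-identityˡ _) ⟩
  ℕtoℚ (suc n) * ℕtoℚ (n !)
    ≡⟨ ℕtoℚ-* (suc n) (n !) ⟨
  ℕtoℚ (suc n !) ∎

Δ-δ-suc : ∀ n x → Δ n δ (suc x) ≡ 0ℚ
Δ-δ-suc zero x = refl
Δ-δ-suc (suc n) x = cong₂ _-_ (Δ-δ-suc n (suc x)) (Δ-δ-suc n x)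

-- Only the value at 0 is nonzero, and it enters the n-th difference with sign (-1)^n.
Δ-δ-zero : ∀ n → Δ n δ 0 ≡ (- 1ℚ) ^Q n
Δ-δ-zero zero = refl
Δ-δ-zero (suc n) = trans (cong₂ _-_ (Δ-δ-suc n 0) (Δ-δ-zero n)) (negate ((- 1ℚ) ^Q n))
  where
  negate : ∀ x → 0ℚ - x ≡ (- 1ℚ) * x
  negate = solve-∀ ℚ-ring

odd⇒sign : ∀ n → ¬ (2 ∣ suc n) → (- 1ℚ) ^Q n ≡ 1ℚ
odd⇒sign zero 2∤ = refl
odd⇒sign (suc zero) 2∤ = ⊥-elim (2∤ ∣-refl)
odd⇒sign (suc (suc n)) 2∤ = begin
  (- 1ℚ) * ((- 1ℚ) * ((- 1ℚ) ^Q n))   ≡⟨ cancel ((- 1ℚ) ^Q n) ⟩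
  (- 1ℚ) ^Q n                         ≡⟨ odd⇒sign n (λ 2∣ → 2∤ (∣m∣n⇒∣m+n ∣-refl 2∣)) ⟩
  1ℚ                                  ∎
  where
  cancel : ∀ x → (- 1ℚ) * ((- 1ℚ) * x) ≡ x
  cancel = solve-∀ ℚ-ring

-- Rationals integral at p, and their divisibility by powers of p.

module PAdic (N : ℕ) (p-prime : Prime (suc N)) where

  p : ℕ
  p = suc N

  P : ℚ
  P = ℕtoℚ p

  ∤-* : ∀ {m n} → ¬ (p ∣ m) → ¬ (p ∣ n) → ¬ (p ∣ m ℕ.* n)
  ∤-* {m} {n} p∤m p∤n p∣mn with euclidsLemma m n p-prime p∣mn
  ... | inj₁ p∣m = p∤m p∣m
  ... | inj₂ p∣n = p∤n p∣n

  ∤⇒≢0 : ∀ {d} → ¬ (p ∣ d) → d ≢ 0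
  ∤⇒≢0 p∤d refl = p∤d (divides 0 refl)

  -- Any representation with denominator prime to p is accepted, not only the reduced one, so
  -- closure under sums and products needs no cancellation of common factors.
  record Integral (x : ℚ) : Set where
    constructor fraction
    field
      den : ℕ
      num : ℤ
      p∤den : ¬ (p ∣ den)
      *-den : x * ℕtoℚ den ≡ ℤtoℚ num

  ℤ-integral : ∀ i → Integral (ℤtoℚ i)
  ℤ-integral i = fraction 1 i p∤1 (ℚₚ.*-identityʳ (ℤtoℚ i))
    where
    p∤1 : ¬ (p ∣ 1)
    p∤1 p∣1 = ¬prime[1] (subst Prime (∣1⇒≡1 p∣1) p-prime)

  ℕ-integral : ∀ n → Integral (ℕtoℚ n)
  ℕ-integral n = ℤ-integral (ℤ.+ n)

  integral-+ : ∀ {x y} → Integral x → Integral y → Integral (x + y)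
  integral-+ {x} {y} (fraction d z p∤d xd≡z) (fraction e w p∤e ye≡w) =
    fraction (d ℕ.* e) (z ℤ.* ℤ.+ e ℤ.+ w ℤ.* ℤ.+ d) (∤-* p∤d p∤e) (begin
      (x + y) * ℕtoℚ (d ℕ.* e)                        ≡⟨ cong ((x + y) *_) (ℕtoℚ-* d e) ⟩
      (x + y) * (ℕtoℚ d * ℕtoℚ e)                     ≡⟨ regroup x y (ℕtoℚ d) (ℕtoℚ e) ⟩
      x * ℕtoℚ d * ℕtoℚ e + y * ℕtoℚ e * ℕtoℚ d       ≡⟨ cong₂ (λ u v → u * ℕtoℚ e + v * ℕtoℚ d) xd≡z ye≡w ⟩
      ℤtoℚ z * ℕtoℚ e + ℤtoℚ w * ℕtoℚ d               ≡⟨ cong₂ _+_ (ℤtoℚ-* z (ℤ.+ e)) (ℤtoℚ-* w (ℤ.+ d)) ⟨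
      ℤtoℚ (z ℤ.* ℤ.+ e) + ℤtoℚ (w ℤ.* ℤ.+ d)         ≡⟨ ℤtoℚ-+ (z ℤ.* ℤ.+ e) (w ℤ.* ℤ.+ d) ⟨
      ℤtoℚ (z ℤ.* ℤ.+ e ℤ.+ w ℤ.* ℤ.+ d)              ∎)
    where
    regroup : ∀ x y d e → (x + y) * (d * e) ≡ x * d * e + y * e * d
    regroup = solve-∀ ℚ-ring

  integral-* : ∀ {x y} → Integral x → Integral y → Integral (x * y)
  integral-* {x} {y} (fraction d z p∤d xd≡z) (fraction e w p∤e ye≡w) =
    fraction (d ℕ.* e) (z ℤ.* w) (∤-* p∤d p∤e) (begin
      x * y * ℕtoℚ (d ℕ.* e)          ≡⟨ cong (x * y *_) (ℕtoℚ-* d e) ⟩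
      x * y * (ℕtoℚ d * ℕtoℚ e)       ≡⟨ regroup x y (ℕtoℚ d) (ℕtoℚ e) ⟩
      x * ℕtoℚ d * (y * ℕtoℚ e)       ≡⟨ cong₂ _*_ xd≡z ye≡w ⟩
      ℤtoℚ z * ℤtoℚ w                 ≡⟨ ℤtoℚ-* z w ⟨
      ℤtoℚ (z ℤ.* w)                  ∎)
    where
    regroup : ∀ x y d e → x * y * (d * e) ≡ x * d * (y * e)
    regroup = solve-∀ ℚ-ring

  integral-neg : ∀ {x} → Integral x → Integral (- x)
  integral-neg {x} ix = subst Integral (negate x) (integral-* (ℤ-integral (ℤ.- (ℤ.+ 1))) ix)
    where
    negate : ∀ x → (- 1ℚ) * x ≡ - x
    negate = solve-∀ ℚ-ring

  integral-^ : ∀ {x} → Integral x → ∀ n → Integral (x ^Q n)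
  integral-^ ix zero = ℕ-integral 1
  integral-^ ix (suc n) = integral-* ix (integral-^ ix n)

  -- Membership in the ideal generated by p^k in the localization of the integers at p.
  record _∈p^_ (x : ℚ) (k : ℕ) : Set where
    constructor multiple
    field
      cofactor : ℚ
      cofactor-integral : Integral cofactor
      ≡-multiple : x ≡ (P ^Q k) * cofactor

  ∈-0 : ∀ k → 0ℚ ∈p^ k
  ∈-0 k = multiple 0ℚ (ℕ-integral 0) (sym (ℚₚ.*-zeroʳ (P ^Q k)))

  ∈-+ : ∀ {k x y} → x ∈p^ k → y ∈p^ k → (x + y) ∈p^ k
  ∈-+ {k} (multiple u iu x≡) (multiple v iv y≡) =
    multiple (u + v) (integral-+ iu iv) (trans (cong₂ _+_ x≡ y≡) (sym (ℚₚ.*-distribˡ-+ (P ^Q k) u v)))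

  ∈-*-∈ : ∀ {j k x y} → x ∈p^ j → y ∈p^ k → (x * y) ∈p^ (j ℕ.+ k)
  ∈-*-∈ {j} {k} (multiple u iu x≡) (multiple v iv y≡) =
    multiple (u * v) (integral-* iu iv) (trans (cong₂ _*_ x≡ y≡)
      (trans (interchange (P ^Q j) u (P ^Q k) v) (cong (_* (u * v)) (sym (^Q-+ P j k)))))
    where
    interchange : ∀ a b c d → a * b * (c * d) ≡ a * c * (b * d)
    interchange = solve-∀ ℚ-ring

  integral⇒∈ : ∀ {x} → Integral x → x ∈p^ 0
  integral⇒∈ {x} ix = multiple x ix (sym (ℚₚ.*-identityˡ x))

  ∈⇒integral : ∀ {k x} → x ∈p^ k → Integral x
  ∈⇒integral {k} (multiple y iy x≡) = subst Integral (sym x≡) (integral-* (integral-^ (ℕ-integral p) k) iy)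

  ∈-* : ∀ {k x c} → Integral c → x ∈p^ k → (c * x) ∈p^ k
  ∈-* ic x∈ = ∈-*-∈ (integral⇒∈ ic) x∈

  ∈-neg : ∀ {k x} → x ∈p^ k → (- x) ∈p^ k
  ∈-neg {k} {x} (multiple y iy x≡) = multiple (- y) (integral-neg iy) (trans (cong -_ x≡) (ℚₚ.neg-distribʳ-* (P ^Q k) y))

  ∈-- : ∀ {k x y} → x ∈p^ k → y ∈p^ k → (x - y) ∈p^ k
  ∈-- x∈ y∈ = ∈-+ x∈ (∈-neg y∈)

  P^∈ : ∀ k → (P ^Q k) ∈p^ k
  P^∈ k = multiple 1ℚ (ℕ-integral 1) (sym (ℚₚ.*-identityʳ (P ^Q k)))

  P∈ : P ∈p^ 1
  P∈ = subst (_∈p^ 1) (ℚₚ.*-identityʳ P) (P^∈ 1)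

  ∈-mono : ∀ {j k x} → j ℕ.≤ k → x ∈p^ k → x ∈p^ j
  ∈-mono {j} {k} {x} j≤k (multiple y iy x≡) =
    multiple ((P ^Q (k ∸ j)) * y) (integral-* (integral-^ (ℕ-integral p) (k ∸ j)) iy) (begin
      x                                 ≡⟨ x≡ ⟩
      (P ^Q k) * y                      ≡⟨ cong (λ i → (P ^Q i) * y) (ℕₚ.m+[n∸m]≡n j≤k) ⟨
      (P ^Q (j ℕ.+ (k ∸ j))) * y        ≡⟨ cong (_* y) (^Q-+ P j (k ∸ j)) ⟩
      (P ^Q j) * (P ^Q (k ∸ j)) * y     ≡⟨ ℚₚ.*-assoc (P ^Q j) (P ^Q (k ∸ j)) y ⟩
      (P ^Q j) * ((P ^Q (k ∸ j)) * y)   ∎)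

  ∈-sumTo : ∀ {k f} m → (∀ i → 1 ℕ.≤ i → i ℕ.≤ m → f i ∈p^ k) → sumTo m f ∈p^ k
  ∈-sumTo {k} zero f∈ = ∈-0 k
  ∈-sumTo (suc m) f∈ = ∈-+ (∈-sumTo m λ i 1≤i i≤m → f∈ i 1≤i (ℕₚ.m≤n⇒m≤1+n i≤m)) (f∈ (suc m) (s≤s z≤n) ℕₚ.≤-refl)

  ∈-^-difference : ∀ {k x y} → Integral x → Integral y → (x - y) ∈p^ k → ∀ n → ((x ^Q n) - (y ^Q n)) ∈p^ k
  ∈-^-difference {k} ix iy x-y∈ zero = ∈-0 k
  ∈-^-difference {k} {x} {y} ix iy x-y∈ (suc n) =
    subst (_∈p^ k) (regroup x y (x ^Q n) (y ^Q n))
      (∈-+ (∈-* ix (∈-^-difference ix iy x-y∈ n)) (∈-* (integral-^ iy n) x-y∈))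
    where
    regroup : ∀ x y a b → x * (a - b) + b * (x - y) ≡ x * a - y * b
    regroup = solve-∀ ℚ-ring

  -- Integers prime to p are units in the localization: 1/a is absorbed into the cofactor.
  ∈-cancel : ∀ {k x} a → ¬ (p ∣ a) → (ℕtoℚ a * x) ∈p^ k → x ∈p^ k
  ∈-cancel {k} {x} a p∤a (multiple y (fraction d z p∤d yd≡z) ax≡) =
    multiple (a⁻¹ * y) (fraction (d ℕ.* a) z (∤-* p∤d p∤a) integral) (*-cancelˡ-ℕtoℚ a {{a≢0}} (begin
      ℕtoℚ a * x                      ≡⟨ ax≡ ⟩
      (P ^Q k) * y                    ≡⟨ ℚₚ.*-identityˡ _ ⟨
      1ℚ * ((P ^Q k) * y)             ≡⟨ cong (_* ((P ^Q k) * y)) (/-cancelʳ (ℤ.+ 1) a {{a≢0}}) ⟨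
      a⁻¹ * ℕtoℚ a * ((P ^Q k) * y)   ≡⟨ regroup₁ a⁻¹ (ℕtoℚ a) (P ^Q k) y ⟩
      ℕtoℚ a * ((P ^Q k) * (a⁻¹ * y)) ∎))
    where
    a≢0 : ℕ.NonZero a
    a≢0 = ℕ.≢-nonZero (∤⇒≢0 p∤a)
    a⁻¹ : ℚ
    a⁻¹ = (ℤ.+ 1 / a) {{a≢0}}
    regroup₁ : ∀ i a c y → i * a * (c * y) ≡ a * (c * (i * y))
    regroup₁ = solve-∀ ℚ-ring
    regroup₂ : ∀ i a d y → i * y * (d * a) ≡ i * a * (y * d)
    regroup₂ = solve-∀ ℚ-ring
    integral : a⁻¹ * y * ℕtoℚ (d ℕ.* a) ≡ ℤtoℚ z
    integral = begin
      a⁻¹ * y * ℕtoℚ (d ℕ.* a)        ≡⟨ cong (a⁻¹ * y *_) (ℕtoℚ-* d a) ⟩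
      a⁻¹ * y * (ℕtoℚ d * ℕtoℚ a)     ≡⟨ regroup₂ a⁻¹ (ℕtoℚ a) (ℕtoℚ d) y ⟩
      a⁻¹ * ℕtoℚ a * (y * ℕtoℚ d)     ≡⟨ cong₂ _*_ (/-cancelʳ (ℤ.+ 1) a {{a≢0}}) yd≡z ⟩
      1ℚ * ℤtoℚ z                     ≡⟨ ℚₚ.*-identityˡ (ℤtoℚ z) ⟩
      ℤtoℚ z                          ∎

  ∈-divide : ∀ {x} → (x * P) ∈p^ 1 → Integral x
  ∈-divide {x} (multiple y iy xP≡) = subst Integral (sym x≡y) iy
    where
    x≡y : x ≡ y
    x≡y = *-cancelˡ-ℕtoℚ p (trans (ℚₚ.*-comm P x) (trans xP≡ (cong (_* y) (ℚₚ.*-identityʳ P))))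

  -- Euclid's lemma puts one factor p into m; cancelling it on both sides lowers the exponent.
  p^∣-cancel : ∀ k m d → ¬ (p ∣ d) → p ℕ.^ k ∣ m ℕ.* d → p ℕ.^ k ∣ m
  p^∣-cancel zero m d p∤d _ = 1∣ m
  p^∣-cancel (suc k) m d p∤d p^∣md with euclidsLemma m d p-prime (∣-trans (m∣m*n (p ℕ.^ k)) p^∣md)
  ... | inj₂ p∣d = ⊥-elim (p∤d p∣d)
  ... | inj₁ (divides m′ refl) =
    subst (_∣ m′ ℕ.* p) (ℕₚ.*-comm (p ℕ.^ k) p) (*-monoˡ-∣ p (p^∣-cancel k m′ d p∤d (*-cancelʳ-∣ p
      (subst₂ _∣_ (ℕₚ.*-comm p (p ℕ.^ k)) (swap m′ p d) p^∣md))))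
    where
    swap : ∀ a b c → a ℕ.* b ℕ.* c ≡ a ℕ.* c ℕ.* b
    swap a b c = trans (ℕₚ.*-assoc a b c) (trans (cong (a ℕ.*_) (ℕₚ.*-comm b c)) (sym (ℕₚ.*-assoc a c b)))

  -- Clearing both denominators gives p^k dividing the reduced numerator times d, and d is prime to
  -- p.
  ∈⇒∣↥ : ∀ k {x} → x ∈p^ k → (ℤ.+ (p ℕ.^ k)) ℤD.∣ (↥ x)
  ∈⇒∣↥ k {x} (multiple y (fraction d z p∤d yd≡z) x≡) =
    p^∣-cancel k ℤ.∣ ↥ x ∣ d p∤d (subst (p ℕ.^ k ∣_) (ℤₚ.abs-* (↥ x) (ℤ.+ d)) (ℤ∣.∣⇒∣ᵤ (ℤ∣.divides (z ℤ.* ↧ x) ↥x*d≡)))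
    where
    n = ↧ₙ x
    regroup₁ : ∀ c y n d → c * y * n * d ≡ y * d * n * c
    regroup₁ = solve-∀ ℚ-ring
    ↥x*d≡ : ↥ x ℤ.* ℤ.+ d ≡ z ℤ.* ↧ x ℤ.* ℤ.+ (p ℕ.^ k)
    ↥x*d≡ = ℤtoℚ-injective (begin
      ℤtoℚ (↥ x ℤ.* ℤ.+ d)                    ≡⟨ ℤtoℚ-* (↥ x) (ℤ.+ d) ⟩
      ℤtoℚ (↥ x) * ℕtoℚ d                     ≡⟨ cong (_* ℕtoℚ d) (*-↧ x) ⟨
      x * ℕtoℚ n * ℕtoℚ d                     ≡⟨ cong (λ u → u * ℕtoℚ n * ℕtoℚ d) x≡ ⟩
      (P ^Q k) * y * ℕtoℚ n * ℕtoℚ d          ≡⟨ regroup₁ (P ^Q k) y (ℕtoℚ n) (ℕtoℚ d) ⟩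
      y * ℕtoℚ d * ℕtoℚ n * (P ^Q k)          ≡⟨ cong₂ (λ u v → u * ℕtoℚ n * v) yd≡z (sym (ℕtoℚ-^ p k)) ⟩
      ℤtoℚ z * ℕtoℚ n * ℕtoℚ (p ℕ.^ k)        ≡⟨ cong (_* ℕtoℚ (p ℕ.^ k)) (ℤtoℚ-* z (ℤ.+ n)) ⟨
      ℤtoℚ (z ℤ.* ↧ x) * ℕtoℚ (p ℕ.^ k)       ≡⟨ ℤtoℚ-* (z ℤ.* ↧ x) (ℤ.+ (p ℕ.^ k)) ⟨
      ℤtoℚ (z ℤ.* ↧ x ℤ.* ℤ.+ (p ℕ.^ k))      ∎)

  -- If p divides the numerator of a reduced fraction, it cannot divide the denominator. This needs
  -- at least one factor p, hence the exponent `suc k`.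
  ∣↥⇒∈ : ∀ k {x} → (ℤ.+ (p ℕ.^ suc k)) ℤD.∣ (↥ x) → x ∈p^ suc k
  ∣↥⇒∈ k {x@(mkℚ _ _ coprime)} p^∣↥x = multiple (ℤtoℚ z * n⁻¹) (fraction n z p∤n y*n≡z) (*-cancelˡ-ℕtoℚ n (begin
      ℕtoℚ n * x                                  ≡⟨ ℚₚ.*-comm (ℕtoℚ n) x ⟩
      x * ℕtoℚ n                                  ≡⟨ *-↧ x ⟩
      ℤtoℚ (↥ x)                                  ≡⟨ cong ℤtoℚ (ℤ∣._∣_.equality signed) ⟩
      ℤtoℚ (z ℤ.* ℤ.+ (p ℕ.^ suc k))              ≡⟨ ℤtoℚ-* z (ℤ.+ (p ℕ.^ suc k)) ⟩
      ℤtoℚ z * ℕtoℚ (p ℕ.^ suc k)                 ≡⟨ cong₂ _*_ (sym y*n≡z) (ℕtoℚ-^ p (suc k)) ⟩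
      ℤtoℚ z * n⁻¹ * ℕtoℚ n * (P ^Q suc k)        ≡⟨ regroup (ℤtoℚ z * n⁻¹) (ℕtoℚ n) (P ^Q suc k) ⟩
      ℕtoℚ n * ((P ^Q suc k) * (ℤtoℚ z * n⁻¹))    ∎))
    where
    n = ↧ₙ x
    n⁻¹ = ℤ.+ 1 / n
    signed : (ℤ.+ (p ℕ.^ suc k)) ℤ∣.∣ (↥ x)
    signed = ℤ∣.∣ᵤ⇒∣ p^∣↥x
    z = ℤ∣._∣_.quotient signed
    p∤n : ¬ (p ∣ n)
    p∤n p∣n = ¬prime[1] (subst Prime (Coprime.recompute coprime (∣-trans (m∣m*n (p ℕ.^ k)) p^∣↥x , p∣n)) p-prime)
    y*n≡z : ℤtoℚ z * n⁻¹ * ℕtoℚ n ≡ ℤtoℚ z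
    y*n≡z = trans (ℚₚ.*-assoc (ℤtoℚ z) n⁻¹ (ℕtoℚ n))
      (trans (cong (ℤtoℚ z *_) (/-cancelʳ (ℤ.+ 1) n)) (ℚₚ.*-identityʳ (ℤtoℚ z)))
    regroup : ∀ y n c → y * n * c ≡ n * (c * y)
    regroup = solve-∀ ℚ-ring

  <p⇒∤ : ∀ k → suc k ℕ.≤ N → ¬ (p ∣ suc k)
  <p⇒∤ k k<N = >⇒∤ (s≤s k<N)

  C∈ : ∀ k → 1 ℕ.≤ k → k ℕ.≤ N → ℕtoℚ (p C k) ∈p^ 1
  C∈ (suc k) _ k<N = ∈-cancel (suc k) (<p⇒∤ k k<N) (subst (_∈p^ 1) eq (∈-*-∈ P∈ (integral⇒∈ (ℕ-integral (N C k)))))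
    where
    eq : P * ℕtoℚ (N C k) ≡ ℕtoℚ (suc k) * ℕtoℚ (p C suc k)
    eq = trans (sym (ℕtoℚ-* p (N C k))) (trans (cong ℕtoℚ (sym ([k+1]*C N k))) (ℕtoℚ-* (suc k) (p C suc k)))

  -- Induction on a: in (1 + a)^p all terms strictly between the ends are divisible by p.
  fermat : ∀ a → ((ℕtoℚ a ^Q p) - ℕtoℚ a) ∈p^ 1
  fermat zero = subst (_∈p^ 1) (sym (zero-case (0ℚ ^Q N))) (∈-0 1)
    where
    zero-case : ∀ x → 0ℚ * x - 0ℚ ≡ 0ℚ
    zero-case = solve-∀ ℚ-ring
  fermat (suc a) = subst (_∈p^ 1) (sym expand) (∈-+ (fermat a) (∈-sumTo N λ k 1≤k k≤N →
      subst (_∈p^ 1) (ℚₚ.*-comm (A ^Q k) (ℕtoℚ (p C k))) (∈-* (integral-^ (ℕ-integral a) k) (C∈ k 1≤k k≤N))))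
    where
    A = ℕtoℚ a
    S = sumTo N (λ k → ℕtoℚ (p C k) * (A ^Q k))
    -- `binomial` expands powers of 1 - z t, so it is used with z = - A and t = 1.
    base : ∀ A → 1ℚ + A ≡ 1ℚ - (- A) * 1ℚ
    base = solve-∀ ℚ-ring
    double-neg : ∀ A → - (- A) ≡ A
    double-neg = solve-∀ ℚ-ring
    term : ∀ k → ℕtoℚ (p C k) * ((- (- A)) ^Q k) * (1ℚ ^Q k) ≡ ℕtoℚ (p C k) * (A ^Q k)
    term k = begin
      ℕtoℚ (p C k) * ((- (- A)) ^Q k) * (1ℚ ^Q k)   ≡⟨ cong₂ (λ u v → ℕtoℚ (p C k) * (u ^Q k) * v) (double-neg A) (1^Q k) ⟩
      ℕtoℚ (p C k) * (A ^Q k) * 1ℚ                  ≡⟨ ℚₚ.*-identityʳ _ ⟩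
      ℕtoℚ (p C k) * (A ^Q k)                       ∎
    rearrange : ∀ S t A → 1ℚ + (S + 1ℚ * t) - (1ℚ + A) ≡ t - A + S
    rearrange = solve-∀ ℚ-ring
    expand : (ℕtoℚ (suc a) ^Q p) - ℕtoℚ (suc a) ≡ (A ^Q p) - A + S
    expand = begin
      (ℕtoℚ (suc a) ^Q p) - ℕtoℚ (suc a)
        ≡⟨ cong (λ u → (u ^Q p) - u) (ℕtoℚ-suc a) ⟩
      ((1ℚ + A) ^Q p) - (1ℚ + A)
        ≡⟨ cong (λ u → (u ^Q p) - (1ℚ + A)) (base A) ⟩
      ((1ℚ - (- A) * 1ℚ) ^Q p) - (1ℚ + A)
        ≡⟨ cong (_- (1ℚ + A)) (trans (binomial (- A) 1ℚ p) (cong (1ℚ +_) (sumTo-cong p λ k _ _ → term k))) ⟩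
      1ℚ + (S + ℕtoℚ (p C p) * (A ^Q p)) - (1ℚ + A)
        ≡⟨ cong (λ c → 1ℚ + (S + ℕtoℚ c * (A ^Q p)) - (1ℚ + A)) (nCn≡1 p) ⟩
      1ℚ + (S + 1ℚ * (A ^Q p)) - (1ℚ + A)
        ≡⟨ rearrange S (A ^Q p) A ⟩
      (A ^Q p) - A + S ∎

  fermat-unit : ∀ a → suc a ℕ.≤ N → (power N (suc a) - 1ℚ) ∈p^ 1
  fermat-unit a a<N = ∈-cancel (suc a) (<p⇒∤ a a<N) (subst (_∈p^ 1) (factor (ℕtoℚ (suc a)) (power N (suc a))) (fermat (suc a)))
    where
    factor : ∀ a x → a * x - a ≡ a * (x - 1ℚ)
    factor = solve-∀ ℚ-ring

  ∈-Δ : ∀ {k f} n x → (∀ i → i ℕ.≤ n ℕ.+ x → f i ∈p^ k) → Δ n f x ∈p^ k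
  ∈-Δ zero x f∈ = f∈ x ℕₚ.≤-refl
  ∈-Δ (suc n) x f∈ = ∈-- (∈-Δ n (suc x) λ i i≤ → f∈ i (subst (i ℕ.≤_) (ℕₚ.+-suc n x) i≤))
                         (∈-Δ n x λ i i≤ → f∈ i (ℕₚ.m≤n⇒m≤1+n i≤))

  module Odd (2∤p : ¬ (2 ∣ p)) where

    sign : (- 1ℚ) ^Q N ≡ 1ℚ
    sign = odd⇒sign N 2∤p

    -- By Fermat, x^(p-1) ≡ 1 - δ(x) for 0 ≤ x < p; apply the (p-1)-st difference at 0 to both sides.
    wilson : (ℕtoℚ (N !) + 1ℚ) ∈p^ 1
    wilson = subst (_∈p^ 1) Δf≡ (∈-Δ N 0 λ i i≤ → f∈ i (subst (i ℕ.≤_) (ℕₚ.+-identityʳ N) i≤))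
      where
      N≢0 : N ≢ 0
      N≢0 refl = ¬prime[1] p-prime
      0<N : 0 ℕ.< N
      0<N = ℕₚ.n≢0⇒n>0 N≢0
      f : ℕ → ℚ
      -- `power 0` is the constant 1, and δ corrects it at 0, where x^(p-1) is 0. The shape with
      -- factors - 1 is the one `Δ-linear` accepts.
      f i = power N i + (- 1ℚ) * (power 0 i + (- 1ℚ) * δ i)
      0^ : ∀ n → n ≢ 0 → 0ℚ ^Q n ≡ 0ℚ
      0^ zero n≢0 = ⊥-elim (n≢0 refl)
      0^ (suc n) _ = ℚₚ.*-zeroˡ (0ℚ ^Q n)
      f∈ : ∀ i → i ℕ.≤ N → f i ∈p^ 1
      f∈ zero _ = subst (_∈p^ 1) (cong (_+ 0ℚ) (sym (0^ N N≢0))) (∈-0 1)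
      f∈ (suc i) i<N = fermat-unit i i<N
      Δf≡ : Δ N f 0 ≡ ℕtoℚ (N !) + 1ℚ
      Δf≡ = begin
        Δ N f 0
          ≡⟨ Δ-linear N (power N) (- 1ℚ) _ 0 ⟩
        Δ N (power N) 0 + (- 1ℚ) * Δ N (λ i → power 0 i + (- 1ℚ) * δ i) 0
          ≡⟨ cong₂ (λ u v → u + (- 1ℚ) * v) (Δ-power-! N 0) (Δ-linear N (power 0) (- 1ℚ) δ 0) ⟩
        ℕtoℚ (N !) + (- 1ℚ) * (Δ N (power 0) 0 + (- 1ℚ) * Δ N δ 0)
          ≡⟨ cong₂ (λ u v → ℕtoℚ (N !) + (- 1ℚ) * (u + (- 1ℚ) * v)) (Δ-power-< 0 N 0 0<N) (trans (Δ-δ-zero N) sign) ⟩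
        ℕtoℚ (N !) + 1ℚ ∎

-- The recursion satisfied by the Wilson quotient.

module Wilson (N : ℕ) (p-prime : Prime (suc N)) (2∤p : ¬ (2 ∣ suc N)) where

  open PAdic N p-prime
  open Odd 2∤p

  W : ℚ
  W = wilsonQ p

  q : ℕ → ℚ
  q = fermatQ p

  W*P : W * P ≡ ℕtoℚ (N !) + 1ℚ
  W*P = trans (/-cancelʳ (ℤ.+ (N ! ℕ.+ 1)) p) (ℕtoℚ-+ (N !) 1)

  q*P : ∀ a → q a * P ≡ power N a - 1ℚ
  q*P a = begin
    q a * P                                     ≡⟨ /-cancelʳ (ℤ.+ (a ℕ.^ N) ℤ.- ℤ.+ 1) p ⟩
    ℤtoℚ (ℤ.+ (a ℕ.^ N) ℤ.- ℤ.+ 1)              ≡⟨ ℤtoℚ-+ (ℤ.+ (a ℕ.^ N)) (ℤ.- (ℤ.+ 1)) ⟩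
    ℕtoℚ (a ℕ.^ N) - 1ℚ                         ≡⟨ cong (_- 1ℚ) (ℕtoℚ-^ a N) ⟩
    power N a - 1ℚ                              ∎

  W-integral : Integral W
  W-integral = ∈-divide (subst (_∈p^ 1) (sym W*P) wilson)

  q-integral : ∀ a → 1 ℕ.≤ a → a ℕ.≤ N → Integral (q a)
  q-integral (suc a) _ a<N = ∈-divide (subst (_∈p^ 1) (sym (q*P (suc a))) (fermat-unit a a<N))

  σ : ℕ → ℚ
  σ = sigmaHatQ p

  shift-integral : ∀ r {f} → (∀ k → Integral (f k)) → ∀ k → Integral (shift r f k)
  shift-integral zero f-int k = f-int k
  shift-integral (suc r) f-int zero = ℕ-integral 0
  shift-integral (suc r) f-int (suc k) = shift-integral r f-int k

  linProd-integral : ∀ u M → (∀ a → 1 ℕ.≤ a → a ℕ.≤ M → Integral (u a)) → ∀ k → Integral (linProd u M k)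
  linProd-integral u zero u-int zero = ℕ-integral 1
  linProd-integral u zero u-int (suc k) = ℕ-integral 0
  linProd-integral u (suc M) u-int k =
    integral-+ (rec k) (integral-* (integral-neg (u-int (suc M) (s≤s z≤n) ℕₚ.≤-refl)) (shift-integral 1 rec k))
    where rec = linProd-integral u M λ a 1≤a a≤M → u-int a 1≤a (ℕₚ.m≤n⇒m≤1+n a≤M)

  -1-integral : Integral (- 1ℚ)
  -1-integral = ℤ-integral (ℤ.- (ℤ.+ 1))

  σ-integral : ∀ k → Integral (σ (suc k))
  σ-integral k = subst Integral (sym (sigmaHat≡linProd q N k))
    (integral-* (integral-^ -1-integral (suc k)) (linProd-integral q N q-integral (suc k)))

  prodTo-! : ∀ M → prodTo M (λ a → power N a) ≡ ℕtoℚ (M !) ^Q N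
  prodTo-! zero = sym (1^Q N)
  prodTo-! (suc M) = begin
    prodTo M (power N) * power N (suc M)          ≡⟨ cong (_* power N (suc M)) (prodTo-! M) ⟩
    (ℕtoℚ (M !) ^Q N) * (ℕtoℚ (suc M) ^Q N)       ≡⟨ ℚₚ.*-comm (ℕtoℚ (M !) ^Q N) _ ⟩
    (ℕtoℚ (suc M) ^Q N) * (ℕtoℚ (M !) ^Q N)       ≡⟨ ^Q-distrib-* (ℕtoℚ (suc M)) (ℕtoℚ (M !)) N ⟨
    (ℕtoℚ (suc M) * ℕtoℚ (M !)) ^Q N              ≡⟨ cong (_^Q N) (ℕtoℚ-* (suc M) (M !)) ⟨
    ℕtoℚ (suc M !) ^Q N                           ∎

  prodTo-cong : ∀ {f g} M → (∀ a → f a ≡ g a) → prodTo M f ≡ prodTo M g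
  prodTo-cong zero eq = refl
  prodTo-cong (suc M) eq = cong₂ _*_ (prodTo-cong M eq) (eq (suc M))

  neg-^Q : ∀ x k → (- x) ^Q k ≡ ((- 1ℚ) ^Q k) * (x ^Q k)
  neg-^Q x k = trans (cong (_^Q k) (negate x)) (^Q-distrib-* (- 1ℚ) x k)
    where
    negate : ∀ x → - x ≡ (- 1ℚ) * x
    negate = solve-∀ ℚ-ring

  -- The product is evaluated at t = - p: the sign (-1)^k of the power then cancels the one relating
  -- `sigmaHat` to `linProd`.
  σ-expansion : 1ℚ + sumTo N (λ k → σ k * (P ^Q k)) ≡ ℕtoℚ (N !) ^Q N
  σ-expansion = begin
    1ℚ + sumTo N (λ k → σ k * (P ^Q k))
      ≡⟨ cong (1ℚ +_) (sumTo-cong N term) ⟩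
    1ℚ + sumTo N (λ k → linProd q N k * ((- P) ^Q k))
      ≡⟨ linProd-eval q (- P) N ⟩
    prodTo N (λ a → 1ℚ - q a * (- P))
      ≡⟨ prodTo-cong N (λ a → trans (double-neg (q a) P) (trans (cong (1ℚ +_) (q*P a)) (cancel (power N a)))) ⟩
    prodTo N (power N)
      ≡⟨ prodTo-! N ⟩
    ℕtoℚ (N !) ^Q N ∎
    where
    double-neg : ∀ q P → 1ℚ - q * (- P) ≡ 1ℚ + q * P
    double-neg = solve-∀ ℚ-ring
    cancel : ∀ x → 1ℚ + (x - 1ℚ) ≡ x
    cancel = solve-∀ ℚ-ring
    regroup : ∀ s f t → s * f * t ≡ f * (s * t)
    regroup = solve-∀ ℚ-ring
    term : ∀ k → 1 ℕ.≤ k → k ℕ.≤ N → σ k * (P ^Q k) ≡ linProd q N k * ((- P) ^Q k)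
    term (suc k) _ _ = begin
      σ (suc k) * (P ^Q suc k)
        ≡⟨ cong (_* (P ^Q suc k)) (sigmaHat≡linProd q N k) ⟩
      ((- 1ℚ) ^Q suc k) * linProd q N (suc k) * (P ^Q suc k)
        ≡⟨ regroup ((- 1ℚ) ^Q suc k) (linProd q N (suc k)) (P ^Q suc k) ⟩
      linProd q N (suc k) * (((- 1ℚ) ^Q suc k) * (P ^Q suc k))
        ≡⟨ cong (linProd q N (suc k) *_) (neg-^Q P (suc k)) ⟨
      linProd q N (suc k) * ((- P) ^Q suc k) ∎

  W-expansion : 1ℚ + sumTo N (λ k → ℕtoℚ (N C k) * ((- W) ^Q k) * (P ^Q k)) ≡ ℕtoℚ (N !) ^Q N
  W-expansion = begin
    1ℚ + sumTo N (λ k → ℕtoℚ (N C k) * ((- W) ^Q k) * (P ^Q k))   ≡⟨ binomial W P N ⟨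
    (1ℚ - W * P) ^Q N                                             ≡⟨ cong (λ u → (1ℚ - u) ^Q N) W*P ⟩
    (1ℚ - (ℕtoℚ (N !) + 1ℚ)) ^Q N                                 ≡⟨ cong (_^Q N) (cancel (ℕtoℚ (N !))) ⟩
    (- ℕtoℚ (N !)) ^Q N                                           ≡⟨ neg-^Q (ℕtoℚ (N !)) N ⟩
    ((- 1ℚ) ^Q N) * (ℕtoℚ (N !) ^Q N)                             ≡⟨ cong (_* (ℕtoℚ (N !) ^Q N)) sign ⟩
    1ℚ * (ℕtoℚ (N !) ^Q N)                                        ≡⟨ ℚₚ.*-identityˡ _ ⟩
    ℕtoℚ (N !) ^Q N                                               ∎
    where
    cancel : ∀ x → 1ℚ - (x + 1ℚ) ≡ - x
    cancel = solve-∀ ℚ-ring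

  -- Definitionally the bracket in `recRHS`, with `N` for `p ∸ 1`.
  bracket : (ℕ → ℚ) → ℕ → ℕ → ℚ
  bracket w ℓ ν = σ (suc ν) + ℕtoℚ (N C suc ν) * ((- 1ℚ) ^Q ν) * (w (ℓ ∸ ν) ^Q suc ν)

  coeff : ℕ → ℚ
  -- The sequence is constant, so 0 is only a placeholder for ℓ; the index ν is k - 1.
  coeff k = bracket (λ _ → W) 0 (k ∸ 1)

  coeff-sum : sumTo N (λ k → (P ^Q (k ∸ 1)) * coeff k) ≡ 0ℚ
  coeff-sum = *-cancelˡ-ℕtoℚ p (begin
    P * sumTo N (λ k → (P ^Q (k ∸ 1)) * coeff k)
      ≡⟨ sumTo-* N P _ ⟨
    sumTo N (λ k → P * ((P ^Q (k ∸ 1)) * coeff k))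
      ≡⟨ sumTo-cong N term ⟩
    sumTo N (λ k → σ k * (P ^Q k) + (- 1ℚ) * (ℕtoℚ (N C k) * ((- W) ^Q k) * (P ^Q k)))
      ≡⟨ trans (sumTo-+ N _ _) (cong (S +_) (sumTo-* N (- 1ℚ) _)) ⟩
    S + (- 1ℚ) * T
      ≡⟨ difference S T ⟩
    1ℚ + S - (1ℚ + T)
      ≡⟨ cong₂ _-_ σ-expansion W-expansion ⟩
    (ℕtoℚ (N !) ^Q N) - (ℕtoℚ (N !) ^Q N)
      ≡⟨ ℚₚ.+-inverseʳ (ℕtoℚ (N !) ^Q N) ⟩
    0ℚ
      ≡⟨ ℚₚ.*-zeroʳ P ⟨
    P * 0ℚ ∎)
    where
    S = sumTo N (λ k → σ k * (P ^Q k))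
    T = sumTo N (λ k → ℕtoℚ (N C k) * ((- W) ^Q k) * (P ^Q k))
    difference : ∀ S T → S + (- 1ℚ) * T ≡ 1ℚ + S - (1ℚ + T)
    difference = solve-∀ ℚ-ring
    regroup : ∀ P t s c e w → P * (t * (s + c * e * w)) ≡ s * (P * t) + (- 1ℚ) * (c * ((- 1ℚ) * e * w) * (P * t))
    regroup = solve-∀ ℚ-ring
    term : ∀ k → 1 ℕ.≤ k → k ℕ.≤ N →
      P * ((P ^Q (k ∸ 1)) * coeff k) ≡ σ k * (P ^Q k) + (- 1ℚ) * (ℕtoℚ (N C k) * ((- W) ^Q k) * (P ^Q k))
    term (suc ν) _ _ = begin
      P * ((P ^Q ν) * coeff (suc ν))
        ≡⟨ regroup P (P ^Q ν) (σ (suc ν)) (ℕtoℚ (N C suc ν)) ((- 1ℚ) ^Q ν) (W ^Q suc ν) ⟩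
      σ (suc ν) * (P ^Q suc ν) + (- 1ℚ) * (ℕtoℚ (N C suc ν) * (((- 1ℚ) ^Q suc ν) * (W ^Q suc ν)) * (P ^Q suc ν))
        ≡⟨ cong (λ u → σ (suc ν) * (P ^Q suc ν) + (- 1ℚ) * (ℕtoℚ (N C suc ν) * u * (P ^Q suc ν))) (neg-^Q W (suc ν)) ⟨
      σ (suc ν) * (P ^Q suc ν) + (- 1ℚ) * (ℕtoℚ (N C suc ν) * ((- W) ^Q suc ν) * (P ^Q suc ν)) ∎

  bracket-integral : ∀ ν → Integral (coeff (suc ν))
  bracket-integral ν = integral-+ (σ-integral ν)
    (integral-* (integral-* (ℕ-integral (N C suc ν)) (integral-^ -1-integral ν)) (integral-^ W-integral (suc ν)))

  -- Every omitted term has k > ℓ, and its factor p^(k-1) already supplies p^ℓ because the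
  -- coefficient is integral.
  truncation : ∀ ℓ d → (sumTo (ℓ ℕ.+ d) (λ k → (P ^Q (k ∸ 1)) * coeff k) - sumTo ℓ (λ k → (P ^Q (k ∸ 1)) * coeff k)) ∈p^ ℓ
  truncation ℓ zero = subst (_∈p^ ℓ) (sym eq) (∈-0 ℓ)
    where
    S : ℕ → ℚ
    S m = sumTo m (λ k → (P ^Q (k ∸ 1)) * coeff k)
    eq : S (ℓ ℕ.+ 0) - S ℓ ≡ 0ℚ
    eq = trans (cong (λ m → S m - S ℓ) (ℕₚ.+-identityʳ ℓ)) (ℚₚ.+-inverseʳ (S ℓ))
  truncation ℓ (suc d) = subst (_∈p^ ℓ) (sym eq)
      (∈-+ (truncation ℓ d) (∈-mono (ℕₚ.m≤m+n ℓ d) (subst ((T * coeff (suc (ℓ ℕ.+ d))) ∈p^_) (ℕₚ.+-identityʳ (ℓ ℕ.+ d))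
        (∈-*-∈ (P^∈ (ℓ ℕ.+ d)) (integral⇒∈ (bracket-integral (ℓ ℕ.+ d)))))))
    where
    T = P ^Q (ℓ ℕ.+ d)
    S : ℕ → ℚ
    S m = sumTo m (λ k → (P ^Q (k ∸ 1)) * coeff k)
    move : ∀ a b c → a + b - c ≡ a - c + b
    move = solve-∀ ℚ-ring
    eq : S (ℓ ℕ.+ suc d) - S ℓ ≡ S (ℓ ℕ.+ d) - S ℓ + T * coeff (suc (ℓ ℕ.+ d))
    eq = trans (cong (λ m → S m - S ℓ) (ℕₚ.+-suc ℓ d)) (move (S (ℓ ℕ.+ d)) _ (S ℓ))

  σ₁ : σ 1 ≡ Qp p 1
  σ₁ = begin
    σ 1                               ≡⟨ sigmaHat≡linProd q N 0 ⟩
    (- 1ℚ) * 1ℚ * linProd q N 1       ≡⟨ cong ((- 1ℚ) * 1ℚ *_) (linear N) ⟩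
    (- 1ℚ) * 1ℚ * (- Qp p 1)          ≡⟨ cancel (Qp p 1) ⟩
    Qp p 1                            ∎
    where
    cancel : ∀ x → (- 1ℚ) * 1ℚ * (- x) ≡ x
    cancel = solve-∀ ℚ-ring
    step : ∀ s x → - s + (- x) * 1ℚ ≡ - (s + x * 1ℚ)
    step = solve-∀ ℚ-ring
    linear : ∀ M → linProd q M 1 ≡ - powerSum q M 1
    linear zero = refl
    linear (suc M) = trans (cong₂ (λ u v → u + (- q (suc M)) * v) (linear M) (linProd-head q M)) (step (powerSum q M 1) (q (suc M)))

  -- The full sum over k is 0, so its first `suc ℓ` terms are divisible by p^(ℓ+1). The term k = 1
  -- is Q_p(1) + (p-1) W, which accounts for both p W and - W; the others are the sum over ν = k -
  -- 1.
  W-recursion : ∀ ℓ → suc ℓ ℕ.≤ N → (recRHS p (λ _ → W) (suc ℓ) - W) ∈p^ suc ℓ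
  W-recursion ℓ ℓ<N = subst (_∈p^ suc ℓ) eq (∈-neg (truncation (suc ℓ) (N ∸ suc ℓ)))
    where
    g : ℕ → ℚ
    g k = (P ^Q (k ∸ 1)) * coeff k
    S = sumTo ℓ (λ ν → (P ^Q ν) * coeff (suc ν))
    tail-zero : ∀ x → - (0ℚ - x) ≡ x
    tail-zero = solve-∀ ℚ-ring
    collect : ∀ Q N W S → 1ℚ * (Q + N * 1ℚ * (W * 1ℚ)) + S ≡ Q + (1ℚ + N) * W + S - W
    collect = solve-∀ ℚ-ring
    eq : - (sumTo (suc ℓ ℕ.+ (N ∸ suc ℓ)) g - sumTo (suc ℓ) g) ≡ recRHS p (λ _ → W) (suc ℓ) - W
    eq = begin
      - (sumTo (suc ℓ ℕ.+ (N ∸ suc ℓ)) g - sumTo (suc ℓ) g)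
        ≡⟨ cong (λ u → - (u - sumTo (suc ℓ) g)) (trans (cong (λ m → sumTo m g) (ℕₚ.m+[n∸m]≡n ℓ<N)) coeff-sum) ⟩
      - (0ℚ - sumTo (suc ℓ) g)
        ≡⟨ tail-zero (sumTo (suc ℓ) g) ⟩
      sumTo (suc ℓ) g
        ≡⟨ sumTo-first ℓ g ⟩
      1ℚ * (σ 1 + ℕtoℚ (N C 1) * 1ℚ * (W * 1ℚ)) + S
        ≡⟨ cong₂ (λ u v → 1ℚ * (u + ℕtoℚ v * 1ℚ * (W * 1ℚ)) + S) σ₁ (nC1≡n N) ⟩
      1ℚ * (Qp p 1 + ℕtoℚ N * 1ℚ * (W * 1ℚ)) + S
        ≡⟨ collect (Qp p 1) (ℕtoℚ N) W S ⟩
      Qp p 1 + (1ℚ + ℕtoℚ N) * W + S - W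
        ≡⟨ cong (λ u → Qp p 1 + u * W + S - W) (ℕtoℚ-suc N) ⟨
      recRHS p (λ _ → W) (suc ℓ) - W ∎

  -- The σ parts cancel. The precision p^ℓ of w_ℓ gains one factor from p, and in summand ν the
  -- factor p^ν makes up for the precision p^(ℓ+1-ν) of its entry.
  recRHS-cong : ∀ w ℓ → (∀ i → 1 ℕ.≤ i → i ℕ.≤ ℓ → (w i - W) ∈p^ i) → 1 ℕ.≤ ℓ →
    (recRHS p w (suc ℓ) - recRHS p (λ _ → W) (suc ℓ)) ∈p^ suc ℓ
  recRHS-cong w ℓ w≈W 1≤ℓ = subst (_∈p^ suc ℓ) eq
    (∈-+ (∈-*-∈ P∈ (w≈W ℓ 1≤ℓ ℕₚ.≤-refl)) (∈-sumTo ℓ term∈))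
    where
    term : (ℕ → ℚ) → ℕ → ℚ
    term w ν = (P ^Q ν) * bracket w (suc ℓ) ν
    difference : ℕ → ℚ
    difference ν = ℕtoℚ (N C suc ν) * ((- 1ℚ) ^Q ν) * ((w (suc ℓ ∸ ν) ^Q suc ν) - (W ^Q suc ν))
    term∈ : ∀ ν → 1 ℕ.≤ ν → ν ℕ.≤ ℓ → ((P ^Q ν) * difference ν) ∈p^ suc ℓ
    term∈ ν@(suc ν-1) 1≤ν ν≤ℓ = subst (((P ^Q ν) * difference ν) ∈p^_) (ℕₚ.m+[n∸m]≡n (ℕₚ.m≤n⇒m≤1+n ν≤ℓ))
      (∈-*-∈ (P^∈ ν) (∈-* (integral-* (ℕ-integral (N C suc ν)) (integral-^ -1-integral ν))
        (∈-^-difference wᵢ-integral W-integral wᵢ≈W (suc ν))))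
      where
      i = suc ℓ ∸ ν
      wᵢ≈W : (w i - W) ∈p^ i
      -- From 1 ≤ ν ≤ ℓ the index ℓ + 1 - ν lies between 1 and ℓ, where the congruence is available.
      wᵢ≈W = w≈W i (ℕₚ.m<n⇒0<n∸m (s≤s ν≤ℓ)) (ℕₚ.m∸n≤m ℓ ν-1)
      restore : ∀ x y → x - y + y ≡ x
      restore = solve-∀ ℚ-ring
      wᵢ-integral : Integral (w i)
      wᵢ-integral = subst Integral (restore (w i) W) (integral-+ (∈⇒integral wᵢ≈W) W-integral)
    regroup₁ : ∀ t s c a b → t * (s + c * a) + (- 1ℚ) * (t * (s + c * b)) ≡ t * (c * (a - b))
    regroup₁ = solve-∀ ℚ-ring
    regroup₂ : ∀ Q P w W S T → P * (w - W) + (S + (- 1ℚ) * T) ≡ Q + P * w + S - (Q + P * W + T)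
    regroup₂ = solve-∀ ℚ-ring
    eq : P * (w ℓ - W) + sumTo ℓ (λ ν → (P ^Q ν) * difference ν) ≡ recRHS p w (suc ℓ) - recRHS p (λ _ → W) (suc ℓ)
    eq = begin
      P * (w ℓ - W) + sumTo ℓ (λ ν → (P ^Q ν) * difference ν)
        ≡⟨ cong (P * (w ℓ - W) +_) (sumTo-cong ℓ λ ν _ _ →
             regroup₁ (P ^Q ν) (σ (suc ν)) (ℕtoℚ (N C suc ν) * ((- 1ℚ) ^Q ν)) (w (suc ℓ ∸ ν) ^Q suc ν) (W ^Q suc ν)) ⟨
      P * (w ℓ - W) + sumTo ℓ (λ ν → term w ν + (- 1ℚ) * term (λ _ → W) ν)
        ≡⟨ cong (P * (w ℓ - W) +_) (trans (sumTo-+ ℓ (term w) _) (cong (sumTo ℓ (term w) +_) (sumTo-* ℓ (- 1ℚ) (term (λ _ → W))))) ⟩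
      P * (w ℓ - W) + (sumTo ℓ (term w) + (- 1ℚ) * sumTo ℓ (term (λ _ → W)))
        ≡⟨ regroup₂ (Qp p 1) P (w ℓ) W (sumTo ℓ (term w)) (sumTo ℓ (term (λ _ → W))) ⟩
      recRHS p w (suc ℓ) - recRHS p (λ _ → W) (suc ℓ) ∎

  -- Induction along the recursion.

  module _ (n : ℕ) (n≤N : n ℕ.≤ N) (w : ℕ → ℚ)
    (w₁≡ : (w 1 - Qp p 1) ∈p^ 1)
    (w≡ : ∀ ℓ → 2 ℕ.≤ ℓ → ℓ ℕ.≤ n → (w ℓ - recRHS p w ℓ) ∈p^ ℓ) where

    w₁≈W : 1 ℕ.≤ N → (w 1 - W) ∈p^ 1
    -- At index 1 the sum in `recRHS` is empty, so W ≡ Q_p(1) + p W modulo p; the summand p W is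
    -- then subtracted as a multiple of p.
    w₁≈W 1≤N = subst (_∈p^ 1) (cancel (w 1) (Qp p 1) P W)
      (∈-- (∈-+ w₁≡ (W-recursion 0 1≤N)) (∈-*-∈ P∈ (integral⇒∈ W-integral)))
      where
      cancel : ∀ w Q P W → w - Q + (Q + P * W + 0ℚ - W) - P * W ≡ w - W
      cancel = solve-∀ ℚ-ring

    -- The bound m provides strong induction: step ℓ + 1 draws on all earlier indices, since ν
    -- ranges over 1 to ℓ.
    w≈W-below : ∀ m ℓ → 1 ℕ.≤ ℓ → ℓ ℕ.≤ m → m ℕ.≤ n → (w ℓ - W) ∈p^ ℓ
    w≈W-below (suc m) (suc zero) _ ℓ≤m m≤n = w₁≈W (ℕₚ.≤-trans (s≤s z≤n) (ℕₚ.≤-trans m≤n n≤N))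
    w≈W-below (suc m) (suc ℓ@(suc _)) _ (s≤s ℓ≤m) m<n = subst (_∈p^ suc ℓ)
      (telescope (w (suc ℓ)) (recRHS p w (suc ℓ)) (recRHS p (λ _ → W) (suc ℓ)) W)
      (∈-+ (∈-+ (w≡ (suc ℓ) (s≤s (s≤s z≤n)) (ℕₚ.≤-trans (s≤s ℓ≤m) m<n))
                (recRHS-cong w ℓ (λ i 1≤i i≤ℓ → w≈W-below m i 1≤i (ℕₚ.≤-trans i≤ℓ ℓ≤m) (ℕₚ.<⇒≤ m<n)) (s≤s z≤n)))
           (W-recursion ℓ (ℕₚ.≤-trans (s≤s ℓ≤m) (ℕₚ.≤-trans m<n n≤N))))
      where
      telescope : ∀ a b c d → a - b + (b - c) + (c - d) ≡ a - d
      telescope = solve-∀ ℚ-ring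

    wilson≈w : 1 ℕ.≤ n → (W - w n) ∈p^ n
    wilson≈w 1≤n = subst (_∈p^ n) (flip (w n) W) (∈-neg (w≈W-below n n 1≤n ℕₚ.≤-refl ℕₚ.≤-refl))
      where
      flip : ∀ a b → - (a - b) ≡ b - a
      flip = solve-∀ ℚ-ring

theorem3p2 : (n p : ℕ) → .{{_ : NonZero p}} → 2 ≤ n → Prime p → ¬ (2 ∣ p) → n < p →
    (w : ℕ → ℚ) →
    (∀ ℓ → 1 ≤ ℓ → ℓ ≤ n → Coprime (↧ₙ (w ℓ)) p) →
    CongQ p (w 1) (Qp p 1) →
    (∀ ℓ → 2 ≤ ℓ → ℓ ≤ n → CongQ (p ^ ℓ) (w ℓ) (recRHS p w ℓ)) →
    CongQ (p ^ n) (wilsonQ p) (w n)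
theorem3p2 n (suc N) 2≤n p-prime 2∤p (s≤s n≤N) w _ w₁≡ w≡ =
  ∈⇒∣↥ n (wilson≈w n n≤N w
    -- The first congruence is stated modulo p, whereas `p ^ 1` unfolds to `p * 1`.
    (∣↥⇒∈ 0 (subst (λ M → CongQ M (w 1) (Qp (suc N) 1)) (sym (ℕₚ.*-identityʳ (suc N))) w₁≡))
    (λ { (suc ℓ) 2≤ℓ ℓ≤n → ∣↥⇒∈ ℓ (w≡ (suc ℓ) 2≤ℓ ℓ≤n) })
    (ℕₚ.≤-trans (s≤s z≤n) 2≤n))
  where
  open PAdic N p-prime
  open Wilson N p-prime 2∤p
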